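{- Let $W$ be a 1-planar graph of class $\mathcal C_1$. Then $|E(W)|\le 3.6\,|V(W)|-7.2$. Moreover, this bound is tight: there exists a 1-planar graph $W$ of class $\mathcal C_1$ with $|E(W)|= 3.6\,|V(W)|-7.2$.
   Context: All graphs are finite, simple and undirected. A drawing of a graph in the plane is 1-planar if each edge is crossed at most once; a graph is 1-planar if it has a 1-planar drawing. In 1-planar drawings it is assumed that adjacent edges never cross and no edge crosses itself, so each crossing involves two edges with four distinct endvertices. For a 1-planar drawing $D$, the associated plane graph $D^\times$ is obtained by turning each crossing into a new vertex of degree four, called a false vertex; for a false vertex $c$, $N_{D^\times}(c)$ denotes its set of (four) neighbours in $D^\times$. A 1-planar graph is of class $\mathcal C_0$ if it has a 1-planar drawing $D$ such that $|N_{D^\times}(c_1)\cap N_{D^\times}(c_2)|=0$ for any two distinct false vertices $c_1,c_2$. For $i\in\{1,2\}$, a 1-planar graph is of class $\mathcal C_i$ if it is not of class $\mathcal C_k$ for any $k<i$ and it has a 1-planar drawing $D$ with $|N_{D^\times}(c_1)\cap N_{D^\times}(c_2)|\le i$ for any two distinct false vertices $c_1,c_2$. -}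

module Defs where

open import Data.Bool using (Bool; T; false; not; _∧_)
open import Data.Fin using (Fin; splitAt; _↑ˡ_; _↑ʳ_; _≟_; _<?_)
open import Data.Fin.Properties using (any?)
open import Data.Fin.Subset using (Subset; ∣_∣; _∩_)
open import Data.Integer using (+_)
open import Data.List using (List; length; filter; cartesianProduct; allFin)
open import Data.Nat as ℕ using (ℕ; _+_; _*_; _≤_)
open import Data.Product using (Σ; ∃; _×_; _,_; proj₁; swap)
open import Data.Rational as ℚ using (ℚ)
open import Data.Sum using (_⊎_; inj₁; inj₂)
import Data.Sum as Sum
open import Data.Vec using (tabulate)
open import Function.Bundles using (_↔_; Bijection; Inverse; mk⇔)
open import Level using (0ℓ)
open import Relation.Binary.Bundles using (Setoid)
open import Relation.Binary.Construct.Closure.Equivalence as EqClosure using ()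
open import Relation.Binary.PropositionalEquality using (_≡_; _≢_; refl; cong; cong₂; subst; setoid)
open import Relation.Nullary using (Dec; does; ¬_)
open import Relation.Nullary.Decidable using (T?; _×-dec_; _⊎-dec_; does-⇔)

record Graph (n : ℕ) : Set where
  field
    adj    : Fin n → Fin n → Bool
    sym    : ∀ u v → adj u v ≡ adj v u
    irrefl : ∀ v → adj v v ≡ false

  Adj : Fin n → Fin n → Set
  Adj u v = T (adj u v)

  N : Fin n → Subset n
  N v = tabulate (adj v)

  edges : List (Fin n × Fin n)
  edges = filter (λ (u , v) → (u <? v) ×-dec T? (adj u v))
                 (cartesianProduct (allFin n) (allFin n))

  ∣E∣ : ℕ
  ∣E∣ = length edges

  isolated : List (Fin n)
  isolated = filter (λ v → ∣ N v ∣ ℕ.≟ 0) (allFin n)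

  Nbr : Fin n → Set
  Nbr u = Σ (Fin n) (Adj u)

  Dart : Set
  Dart = Σ (Fin n) Nbr

  Adj-sym : ∀ {u v} → Adj u v → Adj v u
  Adj-sym {u} {v} = subst T (sym u v)

  components : Setoid 0ℓ 0ℓ
  components = EqClosure.setoid Adj

orbits : {A : Set} → (A → A) → Setoid 0ℓ 0ℓ
orbits f = EqClosure.setoid (λ x y → f x ≡ y)

-- The number of equivalence classes of S is k.
HasClasses : Setoid 0ℓ 0ℓ → ℕ → Set
HasClasses S k = Bijection S (setoid (Fin k))

-- A plane graph is given by its rotation system (the cyclic order of the
-- neighbours around each vertex), subject to genus zero.  In which face of the
-- others a component is placed is not recorded: any placement is possible, and
-- none changes the graph.
record PlaneEmbedding {n : ℕ} (G : Graph n) : Set where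
  open Graph G
  field
    rotation : ∀ u → Nbr u ↔ Nbr u

  next : ∀ {u} → Nbr u → Nbr u
  next {u} = Inverse.to (rotation u)

  -- Successor of a dart along the boundary walk of its face.
  faceStep : Dart → Dart
  faceStep (u , v , uv) = v , next (u , Adj-sym uv)

  field
    cyclic  : ∀ u (v w : Nbr u) → Setoid._≈_ (orbits (next {u})) v w
    #faces  : ℕ
    faces   : HasClasses (orbits faceStep) #faces
    #comps  : ℕ
    comps   : HasClasses components #comps
    -- Euler's formula V - E + F = 2 summed over the components, each on its own
    -- sphere.  The genus of a component is never negative, so every component
    -- has genus zero.  An isolated vertex has one face, but no dart to represent it.
    genus-0 : n + (#faces + length isolated) ≡ ∣E∣ + 2 * #comps

SameEdge : ∀ {n} → Fin n × Fin n → Fin n × Fin n → Set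
SameEdge (u , v) (a , b) = (u ≡ a × v ≡ b) ⊎ (u ≡ b × v ≡ a)

-- Two edges ab and xy of W without a common endvertex, designated to cross.
record Crossing {n : ℕ} (W : Graph n) : Set where
  open Graph W
  field
    a b x y : Fin n
    ab      : Adj a b
    xy      : Adj x y
    a≢x     : a ≢ x
    a≢y     : a ≢ y
    b≢x     : b ≢ x
    b≢y     : b ≢ y

  -- uv is one of the two crossing edges.
  Involves : Fin n → Fin n → Set
  Involves u v = SameEdge (u , v) (a , b) ⊎ SameEdge (u , v) (x , y)

  involves? : ∀ u v → Dec (Involves u v)
  involves? u v = (((u ≟ a) ×-dec (v ≟ b)) ⊎-dec ((u ≟ b) ×-dec (v ≟ a)))
            ⊎-dec (((u ≟ x) ×-dec (v ≟ y)) ⊎-dec ((u ≟ y) ×-dec (v ≟ x)))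

  involves-sym : ∀ {u v} → Involves u v → Involves v u
  involves-sym = Sum.map flip flip
    where
    flip : ∀ {u v e} → SameEdge (u , v) e → SameEdge (v , u) e
    flip (inj₁ p) = inj₂ (swap p)
    flip (inj₂ p) = inj₁ (swap p)

  IsEnd : Fin n → Set
  IsEnd u = (u ≡ a ⊎ u ≡ b) ⊎ (u ≡ x ⊎ u ≡ y)

  isEnd? : ∀ u → Dec (IsEnd u)
  isEnd? u = ((u ≟ a) ⊎-dec (u ≟ b)) ⊎-dec ((u ≟ x) ⊎-dec (u ≟ y))

-- Turning each crossing into a new vertex: u ↑ˡ c is the vertex u of W, and
-- n ↑ʳ i is the false vertex of the i-th crossing.
module _ {n c : ℕ} (W : Graph n) (X : Fin c → Crossing W) where
  open Graph W
  open Crossing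

  Crossed : Fin n → Fin n → Set
  Crossed u v = ∃ λ i → Involves (X i) u v

  crossed? : ∀ u v → Dec (Crossed u v)
  crossed? u v = any? (λ i → involves? (X i) u v)

  adj× : Fin n ⊎ Fin c → Fin n ⊎ Fin c → Bool
  adj× (inj₁ u) (inj₁ v) = adj u v ∧ not (does (crossed? u v))
  adj× (inj₁ u) (inj₂ i) = does (isEnd? (X i) u)
  adj× (inj₂ i) (inj₁ u) = does (isEnd? (X i) u)
  adj× (inj₂ _) (inj₂ _) = false

  planarization : Graph (n + c)
  planarization = record
    { adj    = λ p q → adj× (splitAt n p) (splitAt n q)
    ; sym    = λ p q → sym× (splitAt n p) (splitAt n q)
    ; irrefl = λ p → irrefl× (splitAt n p)
    }
    where
    sym× : ∀ p q → adj× p q ≡ adj× q p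
    sym× (inj₁ u) (inj₁ v) = cong₂ (λ s t → s ∧ not t) (sym u v)
      (does-⇔ (mk⇔ (λ (i , p) → i , involves-sym (X i) p)
                   (λ (i , p) → i , involves-sym (X i) p))
              (crossed? u v) (crossed? v u))
    sym× (inj₁ _) (inj₂ _) = refl
    sym× (inj₂ _) (inj₁ _) = refl
    sym× (inj₂ _) (inj₂ _) = refl

    irrefl× : ∀ p → adj× p p ≡ false
    irrefl× (inj₁ u) = cong (_∧ not (does (crossed? u u))) (irrefl u)
    irrefl× (inj₂ _) = refl

record OnePlanarDrawing {n : ℕ} (W : Graph n) : Set where
  field
    #crossings   : ℕ
    crossing     : Fin #crossings → Crossing W
    crossed-once : ∀ i j {u v} → Crossing.Involves (crossing i) u v →
                   Crossing.Involves (crossing j) u v → i ≡ j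

  D× : Graph (n + #crossings)
  D× = planarization W crossing

  falseVertex : Fin #crossings → Fin (n + #crossings)
  falseVertex i = n ↑ʳ i

  field
    embedding : PlaneEmbedding D×

  open PlaneEmbedding embedding public using (next)

  field
    -- The two edges really cross: around the false vertex, the two halves of
    -- either edge are opposite.
    transversal : ∀ i {u v} → Crossing.Involves (crossing i) u v →
                  (p : Graph.Nbr D× (falseVertex i)) → proj₁ p ≡ u ↑ˡ #crossings →
                  proj₁ (next (next p)) ≡ v ↑ˡ #crossings

  -- |N(cᵢ) ∩ N(cⱼ)| in D×
  common : Fin #crossings → Fin #crossings → ℕ
  common i j = ∣ Graph.N D× (falseVertex i) ∩ Graph.N D× (falseVertex j) ∣

Class₀ : ∀ {n} → Graph n → Set
Class₀ W = Σ (OnePlanarDrawing W) λ D → let open OnePlanarDrawing D in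
  ∀ i j → i ≢ j → common i j ≡ 0

Class₁ : ∀ {n} → Graph n → Set
Class₁ W = ¬ Class₀ W × Σ (OnePlanarDrawing W) λ D → let open OnePlanarDrawing D in
  ∀ i j → i ≢ j → common i j ≤ 1

toℚ : ℕ → ℚ
toℚ k = + k ℚ./ 1

module Submission where

-- Discharging on the darts of D×, for the upper bound.  A dart into a false
-- vertex carries weight β, a dart out of one weight 0; among the darts between
-- two vertices of W, those on a triangular face with a false apex (kite darts)
-- carry α and the others 6.  If α + β ≥ 18, α ≥ 6 and β ≥ 9, every face has
-- weight at least 18, except the face of a component K₂.  Take (α , β) = (7 , 11):
-- no edge has a kite on both sides, since two crossings share at most one
-- vertex, so an uncrossed edge carries at most 13 and Euler's formula
-- gives 5 |E| ≤ 18 (n - 2).  With (6 , 12) one gets |E| ≤ 3n - 6 + c for any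
-- drawing with c crossings.  A drawing witnessing class C₀ has 4c ≤ n, so its
-- graph has at most 3n - 6 + n/4 edges.  The cuboctahedron with both diagonals
-- of each of its six squares has n = 12 and |E| = 36 > 33, and it attains the
-- bound 3.6 n - 7.2.

open import Defs
import Algebra.Properties.Semiring.Sum
open import Data.Bool as Bool using (Bool; true; false; T; if_then_else_; not; _∧_; _∨_)
open import Data.Bool.Properties using (T-irrelevant; T-≡; ∨-zeroʳ)
open import Data.Empty using (⊥; ⊥-elim)
open import Data.Fin using (Fin; zero; suc; #_; toℕ; join; splitAt; _↑ˡ_; _↑ʳ_; _≟_; _<?_)
open import Data.Fin.Properties
  using (all?; any?; <-cmp; splitAt-↑ˡ; splitAt-↑ʳ; join-splitAt; ↑ˡ-injective)
open import Data.Fin.Subset using (Subset; ∣_∣; _∩_) renaming (_∈_ to _∈ˢ_)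
open import Data.Fin.Subset.Properties using (x∈p⇒∣p-x∣<∣p∣; x∈p∧x≢y⇒x∈p-y; x∈p∩q⁺)
import Data.Integer as ℤ
import Data.Integer.Properties as ℤ
open import Data.List as List
  using (List; []; _∷_; _++_; length; filter; cartesianProduct; allFin; concat; reverse)
open import Data.List.Membership.Propositional using (_∈_)
open import Data.List.Membership.Propositional.Properties
  using (∈-∃++; ∈-++⁺ˡ; ∈-++⁺ʳ; ∈-++⁻; ∈-allFin; ∈-cartesianProduct⁺)
open import Data.List.Properties using (map-tabulate; map-++; map-∘; map-cong; length-tabulate)
open import Data.List.Relation.Binary.Disjoint.Propositional using (Disjoint)
open import Data.List.Relation.Unary.All as All using (All; []; _∷_)
import Data.List.Relation.Unary.All.Properties as All
open import Data.List.Relation.Unary.AllPairs as AllPairs using ([]; _∷_)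
import Data.List.Relation.Unary.AllPairs.Properties as AllPairs
open import Data.List.Relation.Unary.Any using (here; there)
open import Data.List.Relation.Unary.Unique.Propositional using (Unique)
import Data.List.Relation.Unary.Unique.Propositional.Properties as Unique
open import Data.Nat as ℕ using (ℕ; zero; suc; _+_; _*_; _≤_; z≤n; s≤s)
open import Data.Nat.ListAction using () renaming (sum to sumᴸ)
open import Data.Nat.ListAction.Properties using (sum-++)
open import Data.Nat.Properties hiding (_≟_; _<?_; <-cmp)
open import Data.Nat.Solver using (module +-*-Solver)
open import Data.Product using (Σ; ∃; _×_; _,_; proj₁; proj₂)
import Data.Product.Properties as Product
import Data.Rational as ℚ
import Data.Rational.Properties as ℚ
open import Data.Rational.Unnormalised as ℚᵘ using (mkℚᵘ; *≤*)
import Data.Rational.Unnormalised.Properties as ℚᵘ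
open import Data.Sum using (_⊎_; inj₁; inj₂)
open import Data.Vec using (Vec; []; _∷_; lookup)
import Data.Vec.Membership.DecPropositional as VecMembership
open import Data.Vec.Properties using (lookup⇒[]=; lookup∘tabulate)
open import Function using (_∘_; id)
open import Function.Bundles using (_↔_; Inverse; Bijection; Equivalence; mk↔ₛ′)
open import Level using (Level)
open import Relation.Binary using (Rel; Setoid; tri<; tri≈; tri>)
open import Relation.Binary.Construct.Closure.Equivalence as EqClosure using (EqClosure)
open import Relation.Binary.Construct.Closure.ReflexiveTransitive using (ε; _◅_; _◅◅_)
open import Relation.Binary.Construct.Closure.Symmetric using (fwd; bwd)
open import Relation.Binary.PropositionalEquality
open import Relation.Nullary using (Dec; does; yes; no; ¬_; contradiction)
open import Relation.Nullary.Decidable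
  using (T?; True; toWitness; toWitnessFalse; map′; ¬?; _×-dec_; _⊎-dec_; _→-dec_; dec-true; dec-false)
open import Relation.Unary using (Pred; Decidable)

open Algebra.Properties.Semiring.Sum +-*-semiring
  using (sum-cong-≗; sum-replicate-zero; ∑-distrib-+; ∑-comm; *-distribˡ-sum; *-distribʳ-sum)
  renaming (sum to ∑)

private variable
  ℓ ℓ′ : Level
  A B : Set ℓ
  m n : ℕ

-- Finite sums

⟦_⟧ : Bool → ℕ
⟦ b ⟧ = if b then 1 else 0

∑-mono : {f g : Fin n → ℕ} → (∀ i → f i ≤ g i) → ∑ f ≤ ∑ g
∑-mono {zero}  le = z≤n
∑-mono {suc n} le = +-mono-≤ (le zero) (∑-mono (le ∘ suc))

∑-const : ∀ n k → ∑ {n} (λ _ → k) ≡ n * k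
∑-const zero    k = refl
∑-const (suc n) k = cong (k +_) (∑-const n k)

∑-split : ∀ m {n} (f : Fin (m + n) → ℕ) → ∑ f ≡ ∑ (f ∘ (_↑ˡ n)) + ∑ (f ∘ (m ↑ʳ_))
∑-split zero    f = refl
∑-split (suc m) f = trans (cong (f zero +_) (∑-split m (f ∘ suc))) (sym (+-assoc (f zero) _ _))

∑-δ : (i : Fin n) → ∑ (λ j → ⟦ does (j ≟ i) ⟧) ≡ 1
∑-δ {suc n} zero    = cong suc (sum-replicate-zero n)
∑-δ {suc n} (suc i) = ∑-δ i

∑-allFin : (f : Fin n → ℕ) → sumᴸ (List.map f (allFin n)) ≡ ∑ f
∑-allFin {zero} f = refl
∑-allFin {suc n} f = cong (f zero +_) (trans
  (cong sumᴸ (trans (map-tabulate suc f) (sym (map-tabulate id (f ∘ suc)))))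
  (∑-allFin (f ∘ suc)))

sumᴸ-cartesianProduct : (f : A × B → ℕ) (xs : List A) (ys : List B) →
  sumᴸ (List.map f (cartesianProduct xs ys)) ≡
  sumᴸ (List.map (λ x → sumᴸ (List.map (λ y → f (x , y)) ys)) xs)
sumᴸ-cartesianProduct f []       ys = refl
sumᴸ-cartesianProduct f (x ∷ xs) ys = begin
  sumᴸ (List.map f (List.map (x ,_) ys ++ cartesianProduct xs ys))
    ≡⟨ cong sumᴸ (map-++ f (List.map (x ,_) ys) _) ⟩
  sumᴸ (List.map f (List.map (x ,_) ys) ++ List.map f (cartesianProduct xs ys))
    ≡⟨ sum-++ (List.map f (List.map (x ,_) ys)) _ ⟩
  sumᴸ (List.map f (List.map (x ,_) ys)) + sumᴸ (List.map f (cartesianProduct xs ys))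
    ≡⟨ cong₂ _+_ (cong sumᴸ (sym (map-∘ ys))) (sumᴸ-cartesianProduct f xs ys) ⟩
  _ ∎
  where open ≡-Reasoning

∑-pairs : ∀ m n (f : Fin m × Fin n → ℕ) →
  sumᴸ (List.map f (cartesianProduct (allFin m) (allFin n))) ≡ ∑ λ u → ∑ λ v → f (u , v)
∑-pairs m n f = trans (sumᴸ-cartesianProduct f (allFin m) (allFin n)) (trans
  (∑-allFin (λ u → sumᴸ (List.map (λ v → f (u , v)) (allFin n))))
  (sum-cong-≗ (λ u → ∑-allFin (λ v → f (u , v)))))

length-filter≡ : {P : Pred A ℓ′} (P? : Decidable P) (xs : List A) →
  length (filter P? xs) ≡ sumᴸ (List.map (λ x → ⟦ does (P? x) ⟧) xs)
length-filter≡ P? []       = refl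
length-filter≡ P? (x ∷ xs) with does (P? x)
... | true  = cong suc (length-filter≡ P? xs)
... | false = length-filter≡ P? xs

-- Induction on `ys`: its head is cut out of `xs` at one occurrence. Since `ys` repeats nothing, its
-- tail still lies in what remains.
sumᴸ-⊆ : (f : A → ℕ) {xs ys : List A} → Unique ys → All (_∈ xs) ys →
  sumᴸ (List.map f ys) ≤ sumᴸ (List.map f xs)
sumᴸ-⊆ f [] [] = z≤n
sumᴸ-⊆ f {xs} {y ∷ ys} (y≢ ∷ uniq) (y∈xs ∷ ys⊆xs) with ∈-∃++ y∈xs
... | us , vs , refl = begin
  f y + sumᴸ (List.map f ys)
    ≤⟨ +-mono-≤ ≤-refl (sumᴸ-⊆ f uniq (All.zipWith (λ (y≢z , z∈) → remove y≢z z∈) (y≢ , ys⊆xs))) ⟩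
  f y + sumᴸ (List.map f (us ++ vs))
    ≡⟨ cong (f y +_) (split us vs) ⟩
  f y + (sumᴸ (List.map f us) + sumᴸ (List.map f vs))
    ≡⟨ solve 3 (λ a b c → a :+ (b :+ c) := b :+ (a :+ c)) refl (f y) (sumᴸ (List.map f us)) _ ⟩
  sumᴸ (List.map f us) + (f y + sumᴸ (List.map f vs))
    ≡⟨ split us (y ∷ vs) ⟨
  sumᴸ (List.map f (us ++ y ∷ vs)) ∎
  where
  open ≤-Reasoning
  open +-*-Solver using (solve; _:+_; _:*_; con; _:=_)
  split : ∀ us vs → sumᴸ (List.map f (us ++ vs)) ≡ sumᴸ (List.map f us) + sumᴸ (List.map f vs)
  split us vs = trans (cong sumᴸ (map-++ f us vs)) (sum-++ (List.map f us) _)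
  remove : ∀ {z} → y ≢ z → z ∈ us ++ y ∷ vs → z ∈ us ++ vs
  remove y≢z z∈ with ∈-++⁻ us z∈
  ... | inj₁ z∈us         = ∈-++⁺ˡ z∈us
  ... | inj₂ (here z≡y)   = contradiction (sym z≡y) y≢z
  ... | inj₂ (there z∈vs) = ∈-++⁺ʳ us z∈vs

module _ (G : Graph n) where
  open Graph G using (adj; edges; ∣E∣)

  -- `edges` lists each edge once, smaller end first, whereas the double sum meets it in both
  -- orders.
  ∑-adj : ∑ (λ u → ∑ λ v → ⟦ adj u v ⟧) ≡ ∣E∣ + ∣E∣
  ∑-adj = sym (begin
    ∣E∣ + ∣E∣
      ≡⟨ cong₂ _+_ ∣E∣≡ (trans ∣E∣≡ (∑-comm (λ u v → up u v))) ⟩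
    ∑ (λ u → ∑ λ v → up u v) + ∑ (λ u → ∑ λ v → up v u)
      ≡⟨ ∑-distrib-+ (λ u → ∑ λ v → up u v) _ ⟨
    ∑ (λ u → ∑ (λ v → up u v) + ∑ (λ v → up v u))
      ≡⟨ sum-cong-≗ (λ u → sym (∑-distrib-+ (up u) (λ v → up v u))) ⟩
    ∑ (λ u → ∑ λ v → up u v + up v u)
      ≡⟨ sum-cong-≗ (λ u → sum-cong-≗ (both u)) ⟩
    ∑ (λ u → ∑ λ v → ⟦ adj u v ⟧) ∎)
    where
    open ≡-Reasoning
    up : Fin n → Fin n → ℕ
    up u v = ⟦ does ((u <? v) ×-dec T? (adj u v)) ⟧
    ∣E∣≡ : ∣E∣ ≡ ∑ λ u → ∑ λ v → up u v
    ∣E∣≡ = trans (length-filter≡ _ (cartesianProduct (allFin n) (allFin n))) (∑-pairs n n _)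
    both : ∀ u v → up u v + up v u ≡ ⟦ adj u v ⟧
    both u v with <-cmp u v
    ... | tri< u<v _ v≮u rewrite dec-true (u <? v) u<v | dec-false (v <? u) v≮u = +-identityʳ _
    ... | tri> u≮v _ v<u rewrite dec-false (u <? v) u≮v | dec-true (v <? u) v<u =
      cong ⟦_⟧ (Graph.sym G v u)
    ... | tri≈ u≮u refl _ rewrite dec-false (u <? u) u≮u | Graph.irrefl G u = refl

-- Graphs and plane embeddings

-- The closure also runs steps backwards, hence the two hypotheses. It serves both for orbits of
-- `next` and for components.
EqClosure-invariant : ∀ {R : Rel A ℓ} (P : Pred A ℓ′) →
  (∀ {x y} → R x y → P x → P y) → (∀ {x y} → R x y → P y → P x) →
  ∀ {x y} → EqClosure R x y → P x → P y
EqClosure-invariant P to from ε            px = px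
EqClosure-invariant P to from (fwd r ◅ rs) px = EqClosure-invariant P to from rs (to r px)
EqClosure-invariant P to from (bwd r ◅ rs) px = EqClosure-invariant P to from rs (from r px)

T⇒≡true : ∀ {b} → T b → b ≡ true
T⇒≡true = Equivalence.to T-≡

⟦⟧≤ : ∀ b {k} → (T b → 1 ≤ k) → ⟦ b ⟧ ≤ k
⟦⟧≤ true  h = h _
⟦⟧≤ false h = z≤n

⟦⟧-false : ∀ {b} → ¬ T b → ⟦ b ⟧ ≡ 0
⟦⟧-false {true}  ¬t = contradiction _ ¬t
⟦⟧-false {false} ¬t = refl

x∈p⇒1≤∣p∣ : {p : Subset n} {x : Fin n} → x ∈ˢ p → 1 ≤ ∣ p ∣
x∈p⇒1≤∣p∣ x∈p = ≤-trans (s≤s z≤n) (x∈p⇒∣p-x∣<∣p∣ x∈p)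

x,y∈p⇒2≤∣p∣ : {p : Subset n} {x y : Fin n} → x ≢ y → x ∈ˢ p → y ∈ˢ p → 2 ≤ ∣ p ∣
x,y∈p⇒2≤∣p∣ {p = p} {x} x≢y x∈p y∈p =
  ≤-trans (s≤s (x∈p⇒1≤∣p∣ (x∈p∧x≢y⇒x∈p-y y∈p (x≢y ∘ sym)))) (x∈p⇒∣p-x∣<∣p∣ x∈p)

module _ (G : Graph n) where
  open Graph G hiding (sym)

  Adj⇒∈N : ∀ {u v} → Adj u v → v ∈ˢ N u
  Adj⇒∈N {u} {v} uv = lookup⇒[]= v (N u) (trans (lookup∘tabulate (adj u) v) (T⇒≡true uv))

  Adj⇒≢ : ∀ {u v} → Adj u v → u ≢ v
  Adj⇒≢ {u} uu refl = subst T (irrefl u) uu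

  Nbr-≡ : ∀ {u} {p q : Nbr u} → proj₁ p ≡ proj₁ q → p ≡ q
  Nbr-≡ {p = v , _} refl = cong (v ,_) (T-irrelevant _ _)

  source target : Dart → Fin n
  source (u , _)     = u
  target (_ , v , _) = v

  Dart-≡ : ∀ {d e} → source d ≡ source e → target d ≡ target e → d ≡ e
  Dart-≡ {u , _} refl v≡ = cong (u ,_) (Nbr-≡ v≡)

  reversed : Dart → Dart
  reversed (u , v , uv) = v , u , Adj-sym uv

  ends : Dart → Fin n × Fin n
  ends d = source d , target d

  ends-injective : ∀ {d e} → ends d ≡ ends e → d ≡ e
  ends-injective eq = Dart-≡ (cong proj₁ eq) (cong proj₂ eq)

  -- Extension by zero to all ordered pairs, which turns sums over darts into double sums over
  -- vertices.
  onDart : (Dart → ℕ) → Fin n × Fin n → ℕ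
  onDart W (u , v) with T? (adj u v)
  ... | yes uv = W (u , v , uv)
  ... | no  _  = 0

  onDart-ends : ∀ W d → onDart W (ends d) ≡ W d
  onDart-ends W (u , v , uv) with T? (adj u v)
  ... | yes _   = cong (λ t → W (u , v , t)) (T-irrelevant _ _)
  ... | no  ¬uv = contradiction uv ¬uv

  -- v is isolated (witnessed by w = v), or v and w span a component K₂.
  Lonely : Fin n → Set
  Lonely v = ∃ λ w → ∀ x → (Adj v x → x ≡ w) × (Adj w x → x ≡ v)

  lonely? : ∀ v → Dec (Lonely v)
  lonely? v = any? λ w → all? λ x →
    (T? (adj v x) →-dec (x ≟ w)) ×-dec (T? (adj w x) →-dec (x ≟ v))

  lonely-class : ∀ {u} ((w , _) : Lonely u) {v} → EqClosure Adj u v → v ≡ u ⊎ v ≡ w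
  lonely-class {u} (w , only) r = EqClosure-invariant P to (to ∘ Adj-sym) r (inj₁ refl)
    where
    P : Fin n → Set
    P v = v ≡ u ⊎ v ≡ w
    to : ∀ {x y} → Adj x y → P x → P y
    to {y = y} xy (inj₁ refl) = inj₂ (proj₁ (only y) xy)
    to {y = y} xy (inj₂ refl) = inj₁ (proj₂ (only y) xy)

  lonely-witness : ∀ {u} ((w , _) : Lonely u) → Lonely w
  lonely-witness {u} (w , only) = u , λ x → proj₂ (only x) , proj₁ (only x)

  #lonely : ℕ
  #lonely = ∑ λ v → ⟦ does (lonely? v) ⟧

  -- A component has at most two lonely vertices, and that of `v` has none: the only other vertex in
  -- the component of a lonely vertex is its witness, which is lonely too.
  #lonely-bound : ∀ {k v} → HasClasses components k → ¬ Lonely v → 2 + #lonely ≤ k * 2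
  #lonely-bound {k} {v} comps ¬lv = begin
    2 + #lonely
      -- The summand 2 is charged to the component of `v`, and each lonely vertex to its own
      -- component.
      ≡⟨ cong₂ _+_ (sym total₂) (sum-cong-≗ by-component) ⟩
    ∑ (λ j → 2 * here? j) + ∑ (λ u → ∑ λ j → lonelyIn j u)
      ≡⟨ cong (∑ (λ j → 2 * here? j) +_) (∑-comm (λ u j → lonelyIn j u)) ⟩
    ∑ (λ j → 2 * here? j) + ∑ (λ j → ∑ (lonelyIn j))
      ≡⟨ ∑-distrib-+ (λ j → 2 * here? j) (λ j → ∑ (lonelyIn j)) ⟨
    ∑ (λ j → 2 * here? j + ∑ (lonelyIn j))
      ≤⟨ ∑-mono per-component ⟩
    ∑ (λ (j : Fin k) → 2)
      ≡⟨ ∑-const k 2 ⟩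
    k * 2 ∎
    where
    open ≤-Reasoning
    open Bijection comps using (to; injective)
    here? : Fin k → ℕ
    here? j = ⟦ does (j ≟ to v) ⟧
    lonelyIn : Fin k → Fin n → ℕ
    lonelyIn j u = ⟦ does (lonely? u) ⟧ * ⟦ does (j ≟ to u) ⟧
    total₂ : ∑ (λ j → 2 * here? j) ≡ 2
    total₂ = trans (sym (*-distribˡ-sum 2 here?)) (cong (2 *_) (∑-δ (to v)))
    by-component : ∀ u → ⟦ does (lonely? u) ⟧ ≡ ∑ λ j → lonelyIn j u
    by-component u = sym (trans
      (sym (*-distribˡ-sum ⟦ does (lonely? u) ⟧ (λ j → ⟦ does (j ≟ to u) ⟧)))
      (trans (cong (⟦ does (lonely? u) ⟧ *_) (∑-δ (to u))) (*-identityʳ _)))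
    lonelyIn-≡1 : ∀ {j u} → ¬ lonelyIn j u ≡ 0 → Lonely u × j ≡ to u
    lonelyIn-≡1 {j} {u} ne with lonely? u | j ≟ to u
    ... | yes lu | yes j≡ = lu , j≡
    ... | yes _  | no _   = contradiction refl ne
    ... | no _   | _      = contradiction refl ne
    lonelyIn-≤1 : ∀ j u → lonelyIn j u ≤ 1
    lonelyIn-≤1 j u with does (lonely? u) | does (j ≟ to u)
    ... | true  | true  = ≤-refl
    ... | true  | false = z≤n
    ... | false | _     = z≤n
    at-most-two : ∀ j → ∑ (lonelyIn j) ≤ 2
    at-most-two j with any? (λ u → lonely? u ×-dec (j ≟ to u))
    ... | no none = ≤-trans (∑-mono zeros) (≤-trans (≤-reflexive (sum-replicate-zero n)) z≤n)
      where
      zeros : ∀ u → lonelyIn j u ≤ 0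
      zeros u with lonelyIn j u ℕ.≟ 0
      ... | yes z = ≤-reflexive z
      ... | no ne = contradiction (u , lonelyIn-≡1 ne) none
    ... | yes (u , lu@(w , _) , refl) = begin
      ∑ (lonelyIn j)
        ≤⟨ ∑-mono bound ⟩
      ∑ (λ x → ⟦ does (x ≟ u) ⟧ + ⟦ does (x ≟ w) ⟧)
        ≡⟨ ∑-distrib-+ (λ x → ⟦ does (x ≟ u) ⟧) _ ⟩
      ∑ (λ x → ⟦ does (x ≟ u) ⟧) + ∑ (λ x → ⟦ does (x ≟ w) ⟧)
        ≡⟨ cong₂ _+_ (∑-δ u) (∑-δ w) ⟩
      2 ∎
      where
      bound : ∀ x → lonelyIn j x ≤ ⟦ does (x ≟ u) ⟧ + ⟦ does (x ≟ w) ⟧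
      bound x with lonelyIn j x ℕ.≟ 0
      ... | yes z = ≤-trans (≤-reflexive z) z≤n
      ... | no ne with lonely-class lu {x} (injective (proj₂ (lonelyIn-≡1 ne)))
      ... | inj₁ x≡u rewrite dec-true (x ≟ u) x≡u = ≤-trans (lonelyIn-≤1 j x) (m≤m+n 1 _)
      ... | inj₂ x≡w rewrite dec-true (x ≟ w) x≡w = ≤-trans (lonelyIn-≤1 j x) (m≤n+m 1 _)
    per-component : ∀ j → 2 * here? j + ∑ (lonelyIn j) ≤ 2
    per-component j with j ≟ to v
    ... | no  _    = at-most-two j
    ... | yes refl = ≤-reflexive (cong (2 +_) (≤-antisym
        (≤-trans (∑-mono zeros) (≤-reflexive (sum-replicate-zero n))) z≤n))
      where
      zeros : ∀ u → lonelyIn j u ≤ 0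
      zeros u with lonelyIn j u ℕ.≟ 0
      ... | yes z = ≤-reflexive z
      ... | no ne with lonelyIn-≡1 ne
      ... | lu , eq with lonely-class lu {v} (injective (sym eq))
      ... | inj₁ refl = contradiction lu ¬lv
      ... | inj₂ refl = contradiction (lonely-witness lu) ¬lv

-- Rotations and faces of a plane embedding

module _ {G : Graph n} (E : PlaneEmbedding G) where
  open Graph G hiding (sym)
  open PlaneEmbedding E

  next-injective : ∀ {u} {p q : Nbr u} → next p ≡ next q → p ≡ q
  next-injective {u} eq =
    trans (sym (Inverse.inverseʳ (rotation u) refl)) (Inverse.inverseʳ (rotation u) eq)

  -- By `cyclic` the neighbours of `u` form a single orbit, and the set of `p` and `next p` is
  -- closed under `next` and its inverse. So `u` has degree at most two.
  next²-fixed : ∀ {u} {p : Nbr u} → next (next p) ≡ p → ∀ q → q ≡ p ⊎ q ≡ next p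
  next²-fixed {u} {p} fix q = EqClosure-invariant P to from (cyclic u p q) (inj₁ refl)
    where
    P : Nbr u → Set
    P q = q ≡ p ⊎ q ≡ next p
    to : ∀ {x y} → next x ≡ y → P x → P y
    to refl (inj₁ refl) = inj₂ refl
    to refl (inj₂ refl) = inj₁ fix
    from : ∀ {x y} → next x ≡ y → P y → P x
    from refl (inj₁ eq) = inj₂ (next-injective (trans eq (sym fix)))
    from refl (inj₂ eq) = inj₁ (next-injective eq)

  next-fixed : ∀ {u} {p : Nbr u} → next p ≡ p → ∀ q → q ≡ p
  next-fixed fix q with next²-fixed (trans (cong next fix) fix) q
  ... | inj₁ eq = eq
  ... | inj₂ eq = trans eq fix

  faceStep-injective : ∀ {d e} → faceStep d ≡ faceStep e → d ≡ e
  faceStep-injective {u , v , uv} {x , y , xy} eq with cong (source G) eq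
  ... | refl = Dart-≡ G (cong proj₁ (next-injective {p = u , Adj-sym uv} {x , Adj-sym xy}
                 (Nbr-≡ G (cong (target G) eq)))) refl

  -- A boundary walk of length two turns back at both ends, so `next` has a fixed point at each of
  -- them and both have degree one.
  faceStep²-fixed⇒lonely : ∀ {d} → faceStep (faceStep d) ≡ d → Lonely G (source G d)
  faceStep²-fixed⇒lonely {u , v , uv} eq with cong (source G) eq
  ... | source≡ = v , λ x →
      (λ ux → cong proj₁ (next-fixed {p = v , uv} fix-u (x , ux))) ,
      (λ vx → cong proj₁ (next-fixed {p = u , Adj-sym uv} (Nbr-≡ G source≡) (x , vx)))
    where
    fix-u : next (v , uv) ≡ (v , uv)
    fix-u = Nbr-≡ G (helper (next (u , Adj-sym uv)) source≡ (cong (target G) eq))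
      where
      helper : (p : Nbr v) → proj₁ p ≡ u → target G (faceStep (v , p)) ≡ v →
               proj₁ (next (v , uv)) ≡ v
      helper (.u , vu) refl eq = trans (cong (proj₁ ∘ next) (Nbr-≡ G refl)) eq

  _≈ᶠ_ : Dart → Dart → Set
  _≈ᶠ_ = Setoid._≈_ (orbits faceStep)

  -- Some distinct darts of the face of `d` already weigh `t`. This bounds the weight of the face
  -- from below without listing its whole boundary.
  FaceQuota : ℕ → (Dart → ℕ) → Dart → Set
  FaceQuota t W d = ∃ λ ds → Unique ds × All (d ≈ᶠ_) ds × t ≤ sumᴸ (List.map W ds)

  ∑ᵈ : (Dart → ℕ) → ℕ
  ∑ᵈ W = ∑ λ u → ∑ λ v → onDart G W (u , v)

  -- One representative dart per face supplies a list of darts. Lists of different faces are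
  -- disjoint, so their concatenation counts no dart twice.
  #faces-bound : ∀ t W → (∀ d → FaceQuota t W d) → #faces * t ≤ ∑ᵈ W
  #faces-bound t W quota = begin
    #faces * t
      ≡⟨ cong (_* t) (length-tabulate {n = #faces} id) ⟨
    length (allFin #faces) * t
      ≤⟨ collect (allFin #faces) ⟩
    sumᴸ (List.map W (chosens (allFin #faces)))
      ≡⟨ cong sumᴸ (map-cong (sym ∘ onDart-ends G W) (chosens (allFin #faces))) ⟩
    sumᴸ (List.map (onDart G W ∘ ends G) (chosens (allFin #faces)))
      ≡⟨ cong sumᴸ (map-∘ (chosens (allFin #faces))) ⟩
    sumᴸ (List.map (onDart G W) (List.map (ends G) (chosens (allFin #faces))))
      ≤⟨ sumᴸ-⊆ (onDart G W)
           (Unique.map⁺ (ends-injective G) unique)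
           (All.universal (λ (u , v) → ∈-cartesianProduct⁺ (∈-allFin u) (∈-allFin v)) _) ⟩
    sumᴸ (List.map (onDart G W) (cartesianProduct (allFin n) (allFin n)))
      ≡⟨ ∑-pairs n n (onDart G W) ⟩
    ∑ᵈ W ∎
    where
    open ≤-Reasoning
    face : Dart → Fin #faces
    face = Bijection.to faces
    rep : Fin #faces → Dart
    rep j = proj₁ (Bijection.surjective faces j)
    face-rep : ∀ j → face (rep j) ≡ j
    face-rep j = proj₂ (Bijection.surjective faces j) ε
    chosen : Fin #faces → List Dart
    chosen j = proj₁ (quota (rep j))
    chosens : List (Fin #faces) → List Dart
    chosens = concat ∘ List.map chosen
    face-chosen : ∀ {j d} → d ∈ chosen j → face d ≡ j
    face-chosen {j} d∈ = trans
      (sym (Bijection.cong faces (All.lookup (proj₁ (proj₂ (proj₂ (quota (rep j))))) d∈)))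
      (face-rep j)
    disjoint : ∀ {i j} → i ≢ j → Disjoint (chosen i) (chosen j)
    disjoint i≢j (d∈i , d∈j) = i≢j (trans (sym (face-chosen d∈i)) (face-chosen d∈j))
    unique : Unique (chosens (allFin #faces))
    unique = Unique.concat⁺
      (All.map⁺ (All.universal (λ j → proj₁ (proj₂ (quota (rep j)))) _))
      (AllPairs.map⁺ (AllPairs.map disjoint (Unique.allFin⁺ #faces)))
    collect : ∀ js → length js * t ≤ sumᴸ (List.map W (chosens js))
    collect []       = z≤n
    collect (j ∷ js) = begin
      t + length js * t
        ≤⟨ +-mono-≤ (proj₂ (proj₂ (proj₂ (quota (rep j))))) (collect js) ⟩
      sumᴸ (List.map W (chosen j)) + sumᴸ (List.map W (chosens js))
        ≡⟨ sum-++ (List.map W (chosen j)) _ ⟨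
      sumᴸ (List.map W (chosen j) ++ List.map W (chosens js))
        ≡⟨ cong sumᴸ (map-++ W (chosen j) (chosens js)) ⟨
      sumᴸ (List.map W (chosen j ++ chosens js)) ∎

-- Euler's formula as a bound on weights

module _ {G : Graph n} (E : PlaneEmbedding G) where
  open Graph G hiding (sym)
  open PlaneEmbedding E
  private
    lonely : Fin n → ℕ
    lonely u = ⟦ does (lonely? G u) ⟧

  isolated⇒¬Adj : ∀ {u v} → ∣ N u ∣ ≡ 0 → ¬ Adj u v
  isolated⇒¬Adj {u} ∣N∣≡0 uv with () ← subst (1 ≤_) ∣N∣≡0 (x∈p⇒1≤∣p∣ (Adj⇒∈N G uv))

  -- A lonely vertex either is isolated or has exactly one dart leaving it, never both.
  lonely-degree : ∀ u → ∑ (λ v → ⟦ adj u v ⟧ * lonely u) + ⟦ does (∣ N u ∣ ℕ.≟ 0) ⟧ ≤ lonely u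
  lonely-degree u = go (lonely? G u) (∣ N u ∣ ℕ.≟ 0)
    where
    open ≤-Reasoning
    go : (l : Dec (Lonely G u)) (i : Dec (∣ N u ∣ ≡ 0)) →
      ∑ (λ v → ⟦ adj u v ⟧ * ⟦ does l ⟧) + ⟦ does i ⟧ ≤ ⟦ does l ⟧
    go (no ¬lu) (yes iso) = contradiction
        (u , λ x → (λ ux → contradiction ux (isolated⇒¬Adj iso)) ,
                   (λ ux → contradiction ux (isolated⇒¬Adj iso))) ¬lu
    go (no ¬lu) (no _) = ≤-reflexive (trans (+-identityʳ _) (trans
        (sum-cong-≗ (λ v → *-zeroʳ ⟦ adj u v ⟧)) (sum-replicate-zero n)))
    go (yes _) (yes iso) = ≤-reflexive (cong (_+ 1) (trans
        (sum-cong-≗ (λ v → cong (_* 1) (⟦⟧-false (isolated⇒¬Adj {u} {v} iso)))) (sum-replicate-zero n)))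
    go (yes (w , only)) (no _) = begin
        ∑ (λ v → ⟦ adj u v ⟧ * 1) + 0
          ≡⟨ +-identityʳ _ ⟩
        ∑ (λ v → ⟦ adj u v ⟧ * 1)
          ≤⟨ ∑-mono (λ v → ≤-trans (≤-reflexive (*-identityʳ _)) (⟦⟧≤ (adj u v)
               (λ uv → ≤-reflexive (sym (cong ⟦_⟧ (dec-true (v ≟ w) (proj₁ (only v) uv))))))) ⟩
        ∑ (λ v → ⟦ does (v ≟ w) ⟧)
          ≡⟨ ∑-δ w ⟩
        1 ∎

  -- Paying an extra `t` for each dart that leaves a lonely vertex and for each isolated vertex
  -- costs at most `t` per lonely vertex, by `lonely-degree`.
  ∑ᵈ-+-lonely : ∀ t W →
    ∑ᵈ E (λ d → W d + t * lonely (source G d)) + t * length isolated ≤ ∑ᵈ E W + t * #lonely G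
  ∑ᵈ-+-lonely t W = begin
    ∑ᵈ E W⁺ + t * length isolated
      ≡⟨ cong₂ _+_ (sum-cong-≗ (λ u → trans (sum-cong-≗ (expand u))
           (∑-distrib-+ (λ v → onDart G W (u , v)) (λ v → t * (⟦ adj u v ⟧ * lonely u)))))
           (cong (t *_) (trans (length-filter≡ (λ v → ∣ N v ∣ ℕ.≟ 0) (allFin n)) (∑-allFin iso))) ⟩
    ∑ (λ u → ∑ (λ v → onDart G W (u , v)) + ∑ (λ v → t * (⟦ adj u v ⟧ * lonely u))) + t * ∑ iso
      ≡⟨ cong₂ _+_
           (∑-distrib-+ (λ u → ∑ (λ v → onDart G W (u , v))) (λ u → ∑ (λ v → t * (⟦ adj u v ⟧ * lonely u))))
           (*-distribˡ-sum t iso) ⟩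
    (∑ᵈ E W + ∑ (λ u → ∑ (λ v → t * (⟦ adj u v ⟧ * lonely u)))) + ∑ (λ u → t * iso u)
      ≡⟨ +-assoc (∑ᵈ E W) _ _ ⟩
    ∑ᵈ E W + (∑ (λ u → ∑ (λ v → t * (⟦ adj u v ⟧ * lonely u))) + ∑ (λ u → t * iso u))
      ≡⟨ cong (∑ᵈ E W +_) (∑-distrib-+ (λ u → ∑ (λ v → t * (⟦ adj u v ⟧ * lonely u))) (λ u → t * iso u)) ⟨
    ∑ᵈ E W + ∑ (λ u → ∑ (λ v → t * (⟦ adj u v ⟧ * lonely u)) + t * iso u)
      ≡⟨ cong (∑ᵈ E W +_) (sum-cong-≗ (λ u → trans
           (cong (_+ t * iso u) (sym (*-distribˡ-sum t (λ v → ⟦ adj u v ⟧ * lonely u))))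
           (sym (*-distribˡ-+ t (∑ (λ v → ⟦ adj u v ⟧ * lonely u)) (iso u))))) ⟩
    ∑ᵈ E W + ∑ (λ u → t * (∑ (λ v → ⟦ adj u v ⟧ * lonely u) + iso u))
      ≤⟨ +-monoʳ-≤ (∑ᵈ E W) (∑-mono (λ u → *-monoʳ-≤ t (lonely-degree u))) ⟩
    ∑ᵈ E W + ∑ (λ u → t * lonely u)
      ≡⟨ cong (∑ᵈ E W +_) (*-distribˡ-sum t lonely) ⟨
    ∑ᵈ E W + t * #lonely G ∎
    where
    open ≤-Reasoning
    W⁺ : Dart → ℕ
    W⁺ d = W d + t * lonely (source G d)
    iso : Fin n → ℕ
    iso u = ⟦ does (∣ N u ∣ ℕ.≟ 0) ⟧
    expand : ∀ u v → onDart G W⁺ (u , v) ≡ onDart G W (u , v) + t * (⟦ adj u v ⟧ * lonely u)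
    expand u v with T? (adj u v)
    ... | yes uv rewrite T⇒≡true uv = cong (λ k → W (u , v , uv) + t * k) (sym (+-identityʳ _))
    ... | no ¬uv rewrite ⟦⟧-false ¬uv = sym (*-zeroʳ t)

  -- Every face receives `t` in Euler's formula. The faces of isolated vertices and of components K₂
  -- may lack weight, so each lonely vertex lends them `t`. The term `2 * #comps` repays the loan:
  -- by `#lonely-bound` it is at least `2 + #lonely G`.
  euler-bound : ∀ t W {v} → ¬ Lonely G v →
    (∀ d → ¬ Lonely G (source G d) → FaceQuota E t W d) →
    ∣E∣ * t + 2 * t ≤ n * t + ∑ᵈ E W
  euler-bound t W ¬lonely quota = +-cancelʳ-≤ (t * #lonely G) _ _ (begin
    ∣E∣ * t + 2 * t + t * #lonely G
      ≡⟨ solve 3 (λ e t l → e :* t :+ con 2 :* t :+ t :* l := e :* t :+ (con 2 :+ l) :* t)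
           refl ∣E∣ t (#lonely G) ⟩
    ∣E∣ * t + (2 + #lonely G) * t
      ≤⟨ +-monoʳ-≤ (∣E∣ * t) (*-monoˡ-≤ t (#lonely-bound G comps ¬lonely)) ⟩
    ∣E∣ * t + #comps * 2 * t
      ≡⟨ solve 3 (λ e t k → e :* t :+ k :* con 2 :* t := (e :+ con 2 :* k) :* t) refl ∣E∣ t #comps ⟩
    (∣E∣ + 2 * #comps) * t
      ≡⟨ cong (_* t) genus-0 ⟨
    (n + (#faces + length isolated)) * t
      ≡⟨ solve 4 (λ n f i t → (n :+ (f :+ i)) :* t := n :* t :+ (f :* t :+ t :* i))
           refl n #faces (length isolated) t ⟩
    n * t + (#faces * t + t * length isolated)
      ≤⟨ +-monoʳ-≤ (n * t) (+-monoˡ-≤ (t * length isolated) (#faces-bound E t _ quota⁺)) ⟩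
    n * t + (∑ᵈ E (λ d → W d + t * lonely (source G d)) + t * length isolated)
      ≤⟨ +-monoʳ-≤ (n * t) (∑ᵈ-+-lonely t W) ⟩
    n * t + (∑ᵈ E W + t * #lonely G)
      ≡⟨ +-assoc (n * t) _ _ ⟨
    n * t + ∑ᵈ E W + t * #lonely G ∎)
    where
    open ≤-Reasoning
    open +-*-Solver using (solve; _:+_; _:*_; con; _:=_)
    sum-mono : ∀ {f g : Dart → ℕ} → (∀ d → f d ≤ g d) → ∀ ds →
      sumᴸ (List.map f ds) ≤ sumᴸ (List.map g ds)
    sum-mono f≤g []       = z≤n
    sum-mono f≤g (d ∷ ds) = +-mono-≤ (f≤g d) (sum-mono f≤g ds)
    quota⁺ : ∀ d → FaceQuota E t (λ d → W d + t * lonely (source G d)) d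
    quota⁺ d = by (lonely? G (source G d))
      where
      by : Dec (Lonely G (source G d)) → FaceQuota E t (λ d → W d + t * lonely (source G d)) d
      -- The extra `t` on a dart at a lonely vertex fills the quota by itself.
      by (yes lu) = d ∷ [] , [] ∷ [] , ε ∷ [] , (begin
        t                                    ≡⟨ *-identityʳ t ⟨
        t * 1                                ≡⟨ cong (λ b → t * ⟦ b ⟧) (dec-true (lonely? G (source G d)) lu) ⟨
        t * lonely (source G d)              ≤⟨ m≤n+m _ (W d) ⟩
        W d + t * lonely (source G d)        ≡⟨ +-identityʳ _ ⟨
        W d + t * lonely (source G d) + 0    ∎)
      by (no ¬lu) with quota d ¬lu
      ... | ds , uniq , same , t≤ = ds , uniq , same ,
        ≤-trans t≤ (sum-mono (λ e → m≤m+n (W e) _) ds)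

-- Discharging

module Discharging {n : ℕ} {G : Graph n} (E : PlaneEmbedding G) (Z : Fin n → Bool)
  (Z-independent : ∀ {u v} → Graph.Adj G u v → T (Z u) → ¬ T (Z v))
  (Z-next² : ∀ {z} → T (Z z) → (p : Graph.Nbr G z) →
    PlaneEmbedding.next E (PlaneEmbedding.next E p) ≢ p) where
  open Graph G hiding (sym)
  open PlaneEmbedding E

  -- The target of `faceStep d` is the vertex opposite `d` once the walk closes after three steps.
  Kite : Dart → Set
  Kite d = T (Z (target G (faceStep d))) × faceStep (faceStep (faceStep d)) ≡ d

  kite? : ∀ d → Dec (Kite d)
  kite? d = T? (Z (target G (faceStep d))) ×-dec
    map′ (ends-injective G) (cong (ends G))
      (Product.≡-dec _≟_ _≟_ (ends G (faceStep (faceStep (faceStep d)))) (ends G d))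

  -- At a common apex `next` would exchange the two ends of the edge, against `Z-next²`. Two
  -- different apexes are false vertices with both ends of the edge as common neighbours, which the
  -- hypothesis excludes.
  kite-reversed : (∀ {z z′ u v} → T (Z z) → T (Z z′) → z ≢ z′ → u ≢ v →
                    Adj z u → Adj z v → Adj z′ u → Adj z′ v → ⊥) →
                  ∀ {d} → Kite d → ¬ Kite (reversed G d)
  kite-reversed few {d@(v , w , vw)} (Zc , eq) (Zc′ , eq′) = by (c ≟ c′)
    where
    toW = faceStep d
    toV = faceStep (reversed G d)
    c = target G toW
    c′ = target G toV
    c-w : Nbr c
    c-w = w , Adj-sym (proj₂ (proj₂ toW))
    c′-v : Nbr c′
    c′-v = v , Adj-sym (proj₂ (proj₂ toV))
    c-next : proj₁ (next c-w) ≡ v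
    c-next = cong (source G) eq
    c′-next : proj₁ (next c′-v) ≡ w
    c′-next = cong (source G) eq′
    swapped : ∀ {c c′} → c ≡ c′ → T (Z c) → (p : Nbr c) (q : Nbr c′) →
              proj₁ (next p) ≡ proj₁ q → proj₁ (next q) ≡ proj₁ p → ⊥
    swapped refl Zc p q p↦q q↦p =
      Z-next² Zc p (trans (cong next (Nbr-≡ G p↦q)) (Nbr-≡ G q↦p))
    by : Dec (c ≡ c′) → ⊥
    by (yes c≡c′) = swapped c≡c′ Zc c-w c′-v c-next c′-next
    by (no  c≢c′) = few Zc Zc′ c≢c′ (Adj⇒≢ G vw)
      (subst (Adj c) c-next (proj₂ (next c-w))) (proj₂ c-w)
      (proj₂ c′-v) (subst (Adj c′) c′-next (proj₂ (next c′-v)))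

  module _ (α β : ℕ) where

    weight : Dart → ℕ
    weight d = if Z (target G d) then β else if Z (source G d) then 0 else
               if does (kite? d) then α else 6

    weight-in : ∀ d → T (Z (target G d)) → weight d ≡ β
    weight-in d Zt rewrite T⇒≡true Zt = refl

    weight-out : ∀ d → ¬ T (Z (target G d)) → T (Z (source G d)) → weight d ≡ 0
    weight-out d ¬Zt Zs with Z (target G d)
    ... | true = contradiction _ ¬Zt
    ... | false rewrite T⇒≡true Zs = refl

    weight-kite : ∀ d → ¬ T (Z (source G d)) → ¬ T (Z (target G d)) → Kite d → weight d ≡ α
    weight-kite d ¬Zs ¬Zt kd with Z (target G d) | Z (source G d)
    ... | true  | _     = contradiction _ ¬Zt
    ... | false | true  = contradiction _ ¬Zs
    ... | false | false rewrite dec-true (kite? d) kd = refl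

    weight-plain : ∀ d → ¬ T (Z (source G d)) → ¬ T (Z (target G d)) → ¬ Kite d → weight d ≡ 6
    weight-plain d ¬Zs ¬Zt ¬kd with Z (target G d) | Z (source G d)
    ... | true  | _     = contradiction _ ¬Zt
    ... | false | true  = contradiction _ ¬Zs
    ... | false | false rewrite dec-false (kite? d) ¬kd = refl

    -- Each dart is paired with its reverse. The two darts of an edge at a false vertex weigh
    -- `β + 0`, those of any other edge at most `γ`.
    ∑ᵈ-weight : ∀ γ →
      (∀ d → ¬ T (Z (source G d)) → ¬ T (Z (target G d)) → weight d + weight (reversed G d) ≤ γ) →
      ∑ᵈ E weight + ∑ᵈ E weight ≤ ∑ λ u → ∑ λ v → ⟦ adj u v ⟧ * (if Z u ∨ Z v then β else γ)
    ∑ᵈ-weight γ real = begin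
      ∑ᵈ E weight + ∑ᵈ E weight
        ≡⟨ cong (∑ᵈ E weight +_) (∑-comm (λ u v → w u v)) ⟩
      ∑ (λ u → ∑ λ v → w u v) + ∑ (λ u → ∑ λ v → w v u)
        ≡⟨ ∑-distrib-+ (λ u → ∑ λ v → w u v) _ ⟨
      ∑ (λ u → ∑ (λ v → w u v) + ∑ (λ v → w v u))
        ≡⟨ sum-cong-≗ (λ u → sym (∑-distrib-+ (w u) (λ v → w v u))) ⟩
      ∑ (λ u → ∑ λ v → w u v + w v u)
        ≤⟨ ∑-mono (λ u → ∑-mono (both u)) ⟩
      ∑ (λ u → ∑ λ v → ⟦ adj u v ⟧ * (if Z u ∨ Z v then β else γ)) ∎
      where
      open ≤-Reasoning
      w : Fin n → Fin n → ℕ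
      w u v = onDart G weight (u , v)
      edge : ∀ d → Dec (T (Z (source G d))) → Dec (T (Z (target G d))) →
             weight d + weight (reversed G d) ≤ (if Z (source G d) ∨ Z (target G d) then β else γ)
      edge d@(_ , _ , uv) (yes Zs) (yes Zt) = contradiction Zt (Z-independent uv Zs)
      edge d (yes Zs) (no ¬Zt) rewrite weight-out d ¬Zt Zs | weight-in (reversed G d) Zs
                                     | T⇒≡true Zs = ≤-refl
      edge d (no ¬Zs) (yes Zt) rewrite weight-in d Zt | weight-out (reversed G d) ¬Zs Zt
                                     | T⇒≡true Zt | ∨-zeroʳ (Z (source G d)) = ≤-reflexive (+-identityʳ β)
      edge d (no ¬Zs) (no ¬Zt) with real d ¬Zs ¬Zt
      ... | le with Z (source G d) | Z (target G d)
      ... | true | _ = contradiction _ ¬Zs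
      ... | false | true = contradiction _ ¬Zt
      ... | false | false = le
      both : ∀ u v → w u v + w v u ≤ ⟦ adj u v ⟧ * (if Z u ∨ Z v then β else γ)
      both u v = by (T? (adj u v))
        where
        by : Dec (Adj u v) → w u v + w v u ≤ ⟦ adj u v ⟧ * (if Z u ∨ Z v then β else γ)
        by (yes uv) = begin
          w u v + w v u
            ≡⟨ cong₂ _+_ (onDart-ends G weight (u , v , uv)) (onDart-ends G weight (v , u , Adj-sym uv)) ⟩
          weight (u , v , uv) + weight (v , u , Adj-sym uv)
            ≤⟨ edge (u , v , uv) (T? (Z u)) (T? (Z v)) ⟩
          (if Z u ∨ Z v then β else γ)
            ≡⟨ *-identityˡ _ ⟨
          1 * (if Z u ∨ Z v then β else γ)
            ≡⟨ cong (λ b → ⟦ b ⟧ * (if Z u ∨ Z v then β else γ)) (T⇒≡true uv) ⟨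
          ⟦ adj u v ⟧ * (if Z u ∨ Z v then β else γ) ∎
        by (no ¬uv) = ≤-trans (≤-reflexive (cong₂ _+_ (none ¬uv) (none (¬uv ∘ Adj-sym)))) z≤n
          where
          none : ∀ {u v} → ¬ Adj u v → onDart G weight (u , v) ≡ 0
          none {u} {v} ¬uv with T? (adj u v)
          ... | yes uv = contradiction uv ¬uv
          ... | no  _  = refl

    module _ (6≤α : 6 ≤ α) (9≤β : 9 ≤ β) (18≤α+β : 18 ≤ α + β) where

      weight-real : ∀ d → ¬ T (Z (source G d)) → ¬ T (Z (target G d)) → 6 ≤ weight d
      weight-real d ¬Zs ¬Zt with kite? d
      ... | yes kd = ≤-trans 6≤α (≤-reflexive (sym (weight-kite d ¬Zs ¬Zt kd)))
      ... | no ¬kd = ≤-reflexive (sym (weight-plain d ¬Zs ¬Zt ¬kd))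

      later : ∀ {d} → FaceQuota E 18 weight (faceStep d) → FaceQuota E 18 weight d
      later (ds , uniq , same , le) = ds , uniq , All.map (fwd refl ◅_) same , le

      -- The boundary walk starts with `d = uz`, `out = zv`, `e = vw`, `f = wx`, where `z` is false
      -- and hence `v` is not. The cases ask whether `w` or `x` is false and whether `e` is a kite
      -- dart.
      quota-false : ∀ d → T (Z (target G d)) → FaceQuota E 18 weight d
      quota-false d@(u , z , uz) Zz = by (T? (Z (target G e))) (T? (Z (target G f))) (kite? e)
        where
        out = faceStep d
        v = target G out
        e = faceStep out
        f = faceStep e
        ¬Zv : ¬ T (Z v)
        ¬Zv = Z-independent (proj₂ (proj₂ out)) Zz
        fixed : ∀ {p : Nbr z} → proj₁ p ≡ proj₁ (next p) → ⊥
        fixed {p} eq = Z-next² Zz p (trans (cong next (Nbr-≡ G (sym eq))) (Nbr-≡ G (sym eq)))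
        d≢e : d ≢ e
        d≢e eq = fixed (cong (source G) eq)
        two : ∀ {a b} (g : Dart) → 18 ≤ a + b → weight d ≡ a → b ≤ weight g →
              18 ≤ sumᴸ (List.map weight (d ∷ g ∷ []))
        two g le refl b≤ = ≤-trans le (+-monoʳ-≤ (weight d) (≤-trans b≤ (m≤m+n (weight g) 0)))
        ~e : _≈ᶠ_ E d e
        ~e = fwd refl ◅ fwd refl ◅ ε
        ~f : _≈ᶠ_ E d f
        ~f = fwd refl ◅ fwd refl ◅ fwd refl ◅ ε
        18≤β+β : 18 ≤ β + β
        18≤β+β = +-mono-≤ 9≤β 9≤β
        by : Dec (T (Z (target G e))) → Dec (T (Z (target G f))) → Dec (Kite e) →
             FaceQuota E 18 weight d
        by (yes Zw) _ _ = d ∷ e ∷ [] , (d≢e ∷ []) ∷ [] ∷ [] , ε ∷ ~e ∷ [] ,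
          two e 18≤β+β (weight-in d Zz) (≤-reflexive (sym (weight-in e Zw)))
        -- On a kite the darts `d` and `e` weigh exactly `β + α`.
        by (no ¬Zw) _ (yes ke) = d ∷ e ∷ [] , (d≢e ∷ []) ∷ [] ∷ [] , ε ∷ ~e ∷ [] ,
          two e (subst (18 ≤_) (+-comm α β) 18≤α+β) (weight-in d Zz)
            (≤-reflexive (sym (weight-kite e ¬Zv ¬Zw ke)))
        by (no ¬Zw) (yes Zx) (no ¬ke) = d ∷ f ∷ [] , (d≢f ∷ []) ∷ [] ∷ [] , ε ∷ ~f ∷ [] ,
          two f 18≤β+β (weight-in d Zz) (≤-reflexive (sym (weight-in f Zx)))
          where
          -- If `f` were `d`, the face would be a triangle with apex `z`, and `e` a kite dart.
          d≢f : d ≢ f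
          d≢f eq = ¬ke (subst (λ g → T (Z (target G g))) eq Zz , cong (faceStep ∘ faceStep) (sym eq))
        by (no ¬Zw) (no ¬Zx) (no ¬ke) = d ∷ e ∷ f ∷ [] ,
          (d≢e ∷ d≢f ∷ []) ∷ (e≢f ∷ []) ∷ [] ∷ [] , ε ∷ ~e ∷ ~f ∷ [] ,
          -- The weight is at least 9 + 6 + 6, more than enough.
          +-mono-≤ (≤-trans 9≤β (≤-reflexive (sym (weight-in d Zz))))
            (≤-trans (m≤n+m 9 3) (+-mono-≤ (weight-real e ¬Zv ¬Zw)
              (+-mono-≤ (weight-real f ¬Zw ¬Zx) z≤n)))
          where
          d≢f : d ≢ f
          d≢f eq = ¬Zx (subst (λ g → T (Z (target G g))) eq Zz)
          e≢f : e ≢ f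
          e≢f eq = Adj⇒≢ G (proj₂ (proj₂ e)) (cong (source G) eq)

      -- If one of four consecutive darts ends in a false vertex, `quota-false` applies there.
      -- Otherwise three distinct darts between vertices of W give 6 each.
      quota : ∀ d → ¬ Lonely G (source G d) → FaceQuota E 18 weight d
      quota d ¬lonely = by (Z? d) (Z? e) (Z? f) (Z? g)
        where
        e = faceStep d
        f = faceStep e
        g = faceStep f
        Z? : ∀ d → Dec (T (Z (target G d)))
        Z? d = T? (Z (target G d))
        by : Dec (T (Z (target G d))) → Dec (T (Z (target G e))) →
             Dec (T (Z (target G f))) → Dec (T (Z (target G g))) → FaceQuota E 18 weight d
        by (yes Zd) _ _ _ = quota-false d Zd
        by _ (yes Ze) _ _ = later (quota-false e Ze)
        by _ _ (yes Zf) _ = later (later (quota-false f Zf))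
        by _ _ _ (yes Zg) = later (later (later (quota-false g Zg)))
        -- The dart `d` is left out because its source might be false; the sources of `e`, `f`, `g`
        -- are the targets of `d`, `e`, `f`. Equality of `e` and `g` would mean a face of length
        -- two, hence a lonely source.
        by (no ¬Zd) (no ¬Ze) (no ¬Zf) (no ¬Zg) = e ∷ f ∷ g ∷ [] ,
          (moves e ∷ e≢g ∷ []) ∷ (moves f ∷ []) ∷ [] ∷ [] ,
          (fwd refl ◅ ε) ∷ (fwd refl ◅ fwd refl ◅ ε) ∷ (fwd refl ◅ fwd refl ◅ fwd refl ◅ ε) ∷ [] ,
          +-mono-≤ (weight-real e ¬Zd ¬Ze) (+-mono-≤ (weight-real f ¬Ze ¬Zf)
            (+-mono-≤ (weight-real g ¬Zf ¬Zg) z≤n))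
          where
          moves : ∀ d → d ≢ faceStep d
          moves d eq = Adj⇒≢ G (proj₂ (proj₂ d)) (cong (source G) eq)
          e≢g : e ≢ g
          e≢g eq = ¬lonely (faceStep²-fixed⇒lonely E (sym (faceStep-injective E eq)))

-- Planarizations and drawings

⟦⟧-∨-≤ : ∀ b b′ → ⟦ b ∨ b′ ⟧ ≤ ⟦ b ⟧ + ⟦ b′ ⟧
⟦⟧-∨-≤ true  b′ = s≤s z≤n
⟦⟧-∨-≤ false b′ = ≤-refl

⟦⟧-∨ : ∀ {b b′} → (T b → ¬ T b′) → ⟦ b ∨ b′ ⟧ ≡ ⟦ b ⟧ + ⟦ b′ ⟧
⟦⟧-∨ {true}  {true}  dis = contradiction _ (dis _)
⟦⟧-∨ {true}  {false} dis = refl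
⟦⟧-∨ {false} {b′}    dis = refl

⟦⟧-∧ : ∀ b b′ → ⟦ b ∧ b′ ⟧ ≡ ⟦ b ⟧ * ⟦ b′ ⟧
⟦⟧-∧ true  b′ = sym (+-identityʳ _)
⟦⟧-∧ false b′ = refl

does⇒ : ∀ {p} {P : Set p} (P? : Dec P) → T (does P?) → P
does⇒ (yes p) _ = p

⇒does : ∀ {p} {P : Set p} (P? : Dec P) → P → T (does P?)
⇒does P? p = subst T (sym (dec-true P? p)) _

f≤∑ : (f : Fin n → ℕ) (i : Fin n) → f i ≤ ∑ f
f≤∑ f zero    = m≤m+n (f zero) _
f≤∑ f (suc i) = ≤-trans (f≤∑ (f ∘ suc) i) (m≤n+m _ (f zero))

∑∑-δ : (a : Fin n) (b : Fin n) → ∑ (λ u → ∑ λ v → ⟦ does (u ≟ a) ∧ does (v ≟ b) ⟧) ≡ 1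
∑∑-δ a b = trans
  (sum-cong-≗ (λ u → trans (sum-cong-≗ (λ v → ⟦⟧-∧ (does (u ≟ a)) (does (v ≟ b))))
    (trans (sym (*-distribˡ-sum ⟦ does (u ≟ a) ⟧ (λ v → ⟦ does (v ≟ b) ⟧)))
      (trans (cong (⟦ does (u ≟ a) ⟧ *_) (∑-δ b)) (*-identityʳ _)))))
  (∑-δ a)

∑²-distrib-+ : ∀ {m} (f g : Fin m → Fin n → ℕ) →
  ∑ (λ u → ∑ λ v → f u v + g u v) ≡ ∑ (λ u → ∑ λ v → f u v) + ∑ (λ u → ∑ λ v → g u v)
∑²-distrib-+ f g = trans
  (sum-cong-≗ (λ u → ∑-distrib-+ (f u) (g u)))
  (∑-distrib-+ (λ u → ∑ (f u)) (λ u → ∑ (g u)))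

∑²-*ʳ : ∀ {m} (f : Fin m → Fin n → ℕ) k →
  ∑ (λ u → ∑ λ v → f u v * k) ≡ ∑ (λ u → ∑ λ v → f u v) * k
∑²-*ʳ f k = trans
  (sum-cong-≗ (λ u → sym (*-distribʳ-sum k (f u))))
  (sym (*-distribʳ-sum k (λ u → ∑ (f u))))

module _ {W : Graph n} (X : Crossing W) where
  open Crossing X

  a≢b : a ≢ b
  a≢b = Adj⇒≢ W ab

  x≢y : x ≢ y
  x≢y = Adj⇒≢ W xy

  #ends : ∑ (λ u → ⟦ does (isEnd? u) ⟧) ≡ 4
  #ends = begin
    ∑ (λ u → ⟦ does (isEnd? u) ⟧)
      ≡⟨ sum-cong-≗ (λ u → trans
           (⟦⟧-∨ {is a u ∨ is b u} {is x u ∨ is y u} (disjoint u))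
           (cong₂ _+_ (⟦⟧-∨ {is a u} {is b u} (apart a≢b u)) (⟦⟧-∨ {is x u} {is y u} (apart x≢y u)))) ⟩
    ∑ (λ u → (⟦ is a u ⟧ + ⟦ is b u ⟧) + (⟦ is x u ⟧ + ⟦ is y u ⟧))
      ≡⟨ ∑-distrib-+ (λ u → ⟦ is a u ⟧ + ⟦ is b u ⟧) _ ⟩
    ∑ (λ u → ⟦ is a u ⟧ + ⟦ is b u ⟧) + ∑ (λ u → ⟦ is x u ⟧ + ⟦ is y u ⟧)
      ≡⟨ cong₂ _+_ (∑-distrib-+ (λ u → ⟦ is a u ⟧) _) (∑-distrib-+ (λ u → ⟦ is x u ⟧) _) ⟩
    (∑ (λ u → ⟦ is a u ⟧) + ∑ (λ u → ⟦ is b u ⟧)) + (∑ (λ u → ⟦ is x u ⟧) + ∑ (λ u → ⟦ is y u ⟧))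
      ≡⟨ cong₂ _+_ (cong₂ _+_ (∑-δ a) (∑-δ b)) (cong₂ _+_ (∑-δ x) (∑-δ y)) ⟩
    4 ∎
    where
    open ≡-Reasoning
    is : Fin n → Fin n → Bool
    is v u = does (u ≟ v)
    apart : ∀ {v w} → v ≢ w → ∀ u → T (is v u) → ¬ T (is w u)
    apart {v} {w} v≢w u uv uw = v≢w (trans (sym (does⇒ (u ≟ v) uv)) (does⇒ (u ≟ w) uw))
    disjoint : ∀ u → T (is a u ∨ is b u) → ¬ T (is x u ∨ is y u)
    disjoint u ab xy with does⇒ ((u ≟ a) ⊎-dec (u ≟ b)) ab | does⇒ ((u ≟ x) ⊎-dec (u ≟ y)) xy
    ... | inj₁ refl | inj₁ eq = a≢x eq
    ... | inj₁ refl | inj₂ eq = a≢y eq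
    ... | inj₂ refl | inj₁ eq = b≢x eq
    ... | inj₂ refl | inj₂ eq = b≢y eq

  -- Two edges, each in two orders.
  #involved : ∑ (λ u → ∑ λ v → ⟦ does (involves? u v) ⟧) ≤ 4
  #involved = begin
    ∑ (λ u → ∑ λ v → ⟦ does (involves? u v) ⟧)
      ≤⟨ ∑-mono (λ u → ∑-mono λ v → ≤-trans
           (⟦⟧-∨-≤ (is a b u v ∨ is b a u v) (is x y u v ∨ is y x u v))
           (+-mono-≤ (⟦⟧-∨-≤ (is a b u v) (is b a u v)) (⟦⟧-∨-≤ (is x y u v) (is y x u v)))) ⟩
    ∑ (λ u → ∑ λ v → (⟦ is a b u v ⟧ + ⟦ is b a u v ⟧) + (⟦ is x y u v ⟧ + ⟦ is y x u v ⟧))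
      ≡⟨ ∑²-distrib-+ (λ u v → ⟦ is a b u v ⟧ + ⟦ is b a u v ⟧) _ ⟩
    ∑ (λ u → ∑ λ v → ⟦ is a b u v ⟧ + ⟦ is b a u v ⟧) +
    ∑ (λ u → ∑ λ v → ⟦ is x y u v ⟧ + ⟦ is y x u v ⟧)
      ≡⟨ cong₂ _+_ (∑²-distrib-+ (λ u v → ⟦ is a b u v ⟧) _) (∑²-distrib-+ (λ u v → ⟦ is x y u v ⟧) _) ⟩
    _ ≡⟨ cong₂ _+_ (cong₂ _+_ (∑∑-δ a b) (∑∑-δ b a)) (cong₂ _+_ (∑∑-δ x y) (∑∑-δ y x)) ⟩
    4 ∎
    where
    open ≤-Reasoning
    is : Fin n → Fin n → Fin n → Fin n → Bool
    is v w u u′ = does (u ≟ v) ∧ does (u′ ≟ w)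

isInj₂ : {A B : Set} → A ⊎ B → Bool
isInj₂ (inj₁ _) = false
isInj₂ (inj₂ _) = true

module _ {n c : ℕ} (W : Graph n) (X : Fin c → Crossing W) where
  open Graph W using (adj; ∣E∣)
  open Crossing
  private
    D× = planarization W X
    module D× = Graph D×

  isFalse : Fin (n + c) → Bool
  isFalse p = isInj₂ (splitAt n p)

  uncrossed : Fin n → Fin n → Bool
  uncrossed u v = adj u v ∧ not (does (crossed? W X u v))

  adj-real : ∀ u v → D×.adj (u ↑ˡ c) (v ↑ˡ c) ≡ uncrossed u v
  adj-real u v rewrite splitAt-↑ˡ n u c | splitAt-↑ˡ n v c = refl

  adj-real-false : ∀ u i → D×.adj (u ↑ˡ c) (n ↑ʳ i) ≡ does (isEnd? (X i) u)
  adj-real-false u i rewrite splitAt-↑ˡ n u c | splitAt-↑ʳ n c i = refl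

  adj-false-real : ∀ i u → D×.adj (n ↑ʳ i) (u ↑ˡ c) ≡ does (isEnd? (X i) u)
  adj-false-real i u rewrite splitAt-↑ˡ n u c | splitAt-↑ʳ n c i = refl

  adj-false : ∀ i j → D×.adj (n ↑ʳ i) (n ↑ʳ j) ≡ false
  adj-false i j rewrite splitAt-↑ʳ n c i | splitAt-↑ʳ n c j = refl

  isFalse-↑ˡ : ∀ u → isFalse (u ↑ˡ c) ≡ false
  isFalse-↑ˡ u rewrite splitAt-↑ˡ n u c = refl

  isFalse-↑ʳ : ∀ i → isFalse (n ↑ʳ i) ≡ true
  isFalse-↑ʳ i rewrite splitAt-↑ʳ n c i = refl

  false-independent : ∀ {p q} → D×.Adj p q → T (isFalse p) → ¬ T (isFalse q)
  false-independent {p} {q} pq Zp Zq with splitAt n p | splitAt n q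
  ... | inj₂ _ | inj₂ _ = pq

  isFalse⇒↑ʳ : ∀ {p} → T (isFalse p) → ∃ λ i → p ≡ n ↑ʳ i
  isFalse⇒↑ʳ {p} Zp with splitAt n p in eq
  ... | inj₂ i = i , trans (sym (join-splitAt n c p)) (cong (join n c) eq)

  end-Adj : ∀ i {u} → IsEnd (X i) u → D×.Adj (n ↑ʳ i) (u ↑ˡ c)
  end-Adj i {u} end = subst T (sym (adj-false-real i u)) (⇒does (isEnd? (X i) u) end)

  false-not-lonely : ∀ i → ¬ Lonely D× (n ↑ʳ i)
  false-not-lonely i (w , only) = a≢b (X i) (↑ˡ-injective c _ _ (trans
    (proj₁ (only (a (X i) ↑ˡ c)) (end-Adj i (inj₁ (inj₁ refl))))
    (sym (proj₁ (only (b (X i) ↑ˡ c)) (end-Adj i (inj₁ (inj₂ refl)))))))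

  -- By `next²-fixed` a fixed point would leave at most two neighbours, but the ends `a`, `b`, `x`
  -- are three distinct ones.
  false-next² : (E : PlaneEmbedding D×) → ∀ {z} → T (isFalse z) → (p : D×.Nbr z) →
    PlaneEmbedding.next E (PlaneEmbedding.next E p) ≢ p
  false-next² E {z} Zz p fix with isFalse⇒↑ʳ {z} Zz
  ... | i , refl = pigeon (next²-fixed E fix toA) (next²-fixed E fix toB) (next²-fixed E fix toX)
    where
    toA toB toX : D×.Nbr (n ↑ʳ i)
    toA = a (X i) ↑ˡ c , end-Adj i (inj₁ (inj₁ refl))
    toB = b (X i) ↑ˡ c , end-Adj i (inj₁ (inj₂ refl))
    toX = x (X i) ↑ˡ c , end-Adj i (inj₂ (inj₁ refl))
    clash : ∀ {P Q R : D×.Nbr (n ↑ʳ i)} {u v} → proj₁ P ≡ u ↑ˡ c → proj₁ Q ≡ v ↑ˡ c → u ≢ v →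
            P ≡ R → Q ≡ R → ⊥
    clash P≡ Q≡ u≢v refl refl = u≢v (↑ˡ-injective c _ _ (trans (sym P≡) Q≡))
    pigeon : ∀ {q r} → toA ≡ q ⊎ toA ≡ r → toB ≡ q ⊎ toB ≡ r → toX ≡ q ⊎ toX ≡ r → ⊥
    pigeon (inj₁ s) (inj₁ t) _        = clash refl refl (a≢b (X i)) s t
    pigeon (inj₂ s) (inj₂ t) _        = clash refl refl (a≢b (X i)) s t
    pigeon (inj₁ s) _        (inj₁ t) = clash refl refl (a≢x (X i)) s t
    pigeon (inj₂ s) _        (inj₂ t) = clash refl refl (a≢x (X i)) s t
    pigeon _        (inj₁ s) (inj₁ t) = clash refl refl (b≢x (X i)) s t
    pigeon _        (inj₂ s) (inj₂ t) = clash refl refl (b≢x (X i)) s t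

  -- Ordered pairs are counted, so this is twice the number of uncrossed edges.
  #uncrossed : ℕ
  #uncrossed = ∑ λ u → ∑ λ v → ⟦ uncrossed u v ⟧

  #ends-total : ∑ (λ i → ∑ λ u → ⟦ does (isEnd? (X i) u) ⟧) ≡ c * 4
  #ends-total = trans (sum-cong-≗ (λ i → #ends (X i))) (∑-const c 4)

  -- The four half-edges at each false vertex, in both orders, make up the `c * 8` pairs; all other
  -- edges of `D×` are uncrossed edges of `W`.
  ∑-planarization : ∀ r f →
    ∑ (λ p → ∑ λ q → ⟦ D×.adj p q ⟧ * (if isFalse p ∨ isFalse q then f else r)) ≡
    #uncrossed * r + c * 8 * f
  ∑-planarization r f = begin
    ∑ (λ p → ∑ (g p))
      ≡⟨ ∑-split n (λ p → ∑ (g p)) ⟩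
    ∑ (λ u → ∑ (g (u ↑ˡ c))) + ∑ (λ i → ∑ (g (n ↑ʳ i)))
      ≡⟨ cong₂ _+_ (sum-cong-≗ (λ u → ∑-split n (g (u ↑ˡ c))))
           (sum-cong-≗ (λ i → ∑-split n (g (n ↑ʳ i)))) ⟩
    ∑ (λ u → ∑ (λ v → g (u ↑ˡ c) (v ↑ˡ c)) + ∑ (λ j → g (u ↑ˡ c) (n ↑ʳ j))) +
    ∑ (λ i → ∑ (λ v → g (n ↑ʳ i) (v ↑ˡ c)) + ∑ (λ j → g (n ↑ʳ i) (n ↑ʳ j)))
      ≡⟨ cong₂ _+_
           (sum-cong-≗ (λ u → cong₂ _+_ (sum-cong-≗ (λ v → g-real u v))
             (sum-cong-≗ (λ j → g-real-false u j))))
           (sum-cong-≗ (λ i → cong₂ _+_ (sum-cong-≗ (λ v → g-false-real i v))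
             (trans (sum-cong-≗ (λ j → g-false i j)) (sum-replicate-zero c)))) ⟩
    ∑ (λ u → ∑ (λ v → ⟦ uncrossed u v ⟧ * r) + ∑ (λ j → end u j * f)) +
    ∑ (λ i → ∑ (λ v → end v i * f) + 0)
      ≡⟨ cong₂ _+_ (∑-distrib-+ (λ u → ∑ (λ v → ⟦ uncrossed u v ⟧ * r)) (λ u → ∑ (λ j → end u j * f)))
           (sum-cong-≗ (λ i → +-identityʳ (∑ (λ v → end v i * f)))) ⟩
    (∑ (λ u → ∑ (λ v → ⟦ uncrossed u v ⟧ * r)) + ∑ (λ u → ∑ (λ j → end u j * f))) +
    ∑ (λ i → ∑ (λ v → end v i * f))
      ≡⟨ cong₂ _+_ (cong₂ _+_ (∑²-*ʳ (λ u v → ⟦ uncrossed u v ⟧) r)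
           (trans (∑²-*ʳ end f) (cong (_* f) (trans (∑-comm end) #ends-total))))
           (trans (∑²-*ʳ (λ i v → end v i) f) (cong (_* f) #ends-total)) ⟩
    (#uncrossed * r + c * 4 * f) + c * 4 * f
      ≡⟨ solve 3 (λ s c f → (s :+ c :* con 4 :* f) :+ c :* con 4 :* f := s :+ c :* con 8 :* f)
           refl (#uncrossed * r) c f ⟩
    #uncrossed * r + c * 8 * f ∎
    where
    open ≡-Reasoning
    open +-*-Solver using (solve; _:+_; _:*_; con; _:=_)
    g : Fin (n + c) → Fin (n + c) → ℕ
    g p q = ⟦ D×.adj p q ⟧ * (if isFalse p ∨ isFalse q then f else r)
    end : Fin n → Fin c → ℕ
    end u i = ⟦ does (isEnd? (X i) u) ⟧
    g-real : ∀ u v → g (u ↑ˡ c) (v ↑ˡ c) ≡ ⟦ uncrossed u v ⟧ * r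
    g-real u v rewrite adj-real u v | isFalse-↑ˡ u | isFalse-↑ˡ v = refl
    g-real-false : ∀ u i → g (u ↑ˡ c) (n ↑ʳ i) ≡ end u i * f
    g-real-false u i rewrite adj-real-false u i | isFalse-↑ˡ u | isFalse-↑ʳ i = refl
    g-false-real : ∀ i u → g (n ↑ʳ i) (u ↑ˡ c) ≡ end u i * f
    g-false-real i u rewrite adj-false-real i u | isFalse-↑ʳ i = refl
    g-false : ∀ i j → g (n ↑ʳ i) (n ↑ʳ j) ≡ 0
    g-false i j rewrite adj-false i j = refl

  ∣E×∣ : D×.∣E∣ + D×.∣E∣ ≡ #uncrossed + c * 8
  ∣E×∣ = begin
    D×.∣E∣ + D×.∣E∣
      ≡⟨ ∑-adj D× ⟨
    ∑ (λ p → ∑ λ q → ⟦ D×.adj p q ⟧)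
      ≡⟨ sum-cong-≗ (λ p → sum-cong-≗ λ q → one ⟦ D×.adj p q ⟧ (isFalse p ∨ isFalse q)) ⟩
    ∑ (λ p → ∑ λ q → ⟦ D×.adj p q ⟧ * (if isFalse p ∨ isFalse q then 1 else 1))
      ≡⟨ ∑-planarization 1 1 ⟩
    #uncrossed * 1 + c * 8 * 1
      ≡⟨ cong₂ _+_ (*-identityʳ #uncrossed) (*-identityʳ (c * 8)) ⟩
    #uncrossed + c * 8 ∎
    where
    open ≡-Reasoning
    one : ∀ k b → k ≡ k * (if b then 1 else 1)
    one k true  = sym (*-identityʳ k)
    one k false = sym (*-identityʳ k)

  -- An edge that is not uncrossed is involved in some crossing, and each crossing involves at most
  -- four ordered pairs.
  ∣E∣-bound : ∣E∣ + ∣E∣ ≤ #uncrossed + c * 4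
  ∣E∣-bound = begin
    ∣E∣ + ∣E∣
      ≡⟨ ∑-adj W ⟨
    ∑ (λ u → ∑ λ v → ⟦ adj u v ⟧)
      ≤⟨ ∑-mono (λ u → ∑-mono λ v → cover u v) ⟩
    ∑ (λ u → ∑ λ v → ⟦ uncrossed u v ⟧ + ∑ λ i → inv i u v)
      ≡⟨ ∑²-distrib-+ (λ u v → ⟦ uncrossed u v ⟧) _ ⟩
    #uncrossed + ∑ (λ u → ∑ λ v → ∑ λ i → inv i u v)
      ≡⟨ cong (#uncrossed +_) (trans
           (sum-cong-≗ (λ u → ∑-comm (λ v i → inv i u v)))
           (∑-comm (λ u i → ∑ λ v → inv i u v))) ⟩
    #uncrossed + ∑ (λ i → ∑ λ u → ∑ λ v → inv i u v)
      ≤⟨ +-monoʳ-≤ #uncrossed (∑-mono (λ i → #involved (X i))) ⟩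
    #uncrossed + ∑ (λ (i : Fin c) → 4)
      ≡⟨ cong (#uncrossed +_) (∑-const c 4) ⟩
    #uncrossed + c * 4 ∎
    where
    open ≤-Reasoning
    inv : Fin c → Fin n → Fin n → ℕ
    inv i u v = ⟦ does (involves? (X i) u v) ⟧
    cover : ∀ u v → ⟦ adj u v ⟧ ≤ ⟦ uncrossed u v ⟧ + ∑ (λ i → inv i u v)
    cover u v with adj u v | crossed? W X u v
    ... | false | _     = z≤n
    ... | true  | no _  = s≤s z≤n
    ... | true  | yes (i , iuv) = ≤-trans
      (≤-reflexive (sym (cong ⟦_⟧ (dec-true (involves? (X i) u v) iuv))))
      (f≤∑ (λ i → inv i u v) i)

  -- This is `euler-bound` with quota 18, doubled so that edges are counted as ordered pairs. The
  -- half-edges give `c * 8 * 18` on the left, the false vertices `c * 36` on the right; the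
  -- difference is `c * 108`.
  drawing-bound : (E : PlaneEmbedding D×) {v : Fin (n + c)} → ¬ Lonely D× v →
    let open Discharging E isFalse false-independent (λ {z} → false-next² E {z}) in
    ∀ α β γ → 6 ≤ α → 9 ≤ β → 18 ≤ α + β →
    (∀ d → ¬ T (isFalse (source D× d)) → ¬ T (isFalse (target D× d)) →
      weight α β d + weight α β (reversed D× d) ≤ γ) →
    #uncrossed * 18 + c * 108 + 72 ≤ n * 36 + (#uncrossed * γ + c * 8 * β)
  drawing-bound E ¬lonely α β γ 6≤α 9≤β 18≤α+β real = +-cancelʳ-≤ (c * 36) _ _ (begin
    #uncrossed * 18 + c * 108 + 72 + c * 36
      ≡⟨ solve 2 (λ u c → u :* con 18 :+ c :* con 108 :+ con 72 :+ c :* con 36 :=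
                          (u :+ c :* con 8) :* con 18 :+ con 72) refl #uncrossed c ⟩
    (#uncrossed + c * 8) * 18 + 72
      ≡⟨ cong (λ e → e * 18 + 72) ∣E×∣ ⟨
    (D×.∣E∣ + D×.∣E∣) * 18 + 72
      ≡⟨ solve 1 (λ e → (e :+ e) :* con 18 :+ con 72 :=
                        (e :* con 18 :+ con 2 :* con 18) :+ (e :* con 18 :+ con 2 :* con 18)) refl D×.∣E∣ ⟩
    (D×.∣E∣ * 18 + 2 * 18) + (D×.∣E∣ * 18 + 2 * 18)
      ≤⟨ +-mono-≤ euler euler ⟩
    ((n + c) * 18 + ∑ᵈ E w) + ((n + c) * 18 + ∑ᵈ E w)
      ≡⟨ solve 3 (λ n c s → ((n :+ c) :* con 18 :+ s) :+ ((n :+ c) :* con 18 :+ s) :=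
                          n :* con 36 :+ (s :+ s) :+ c :* con 36) refl n c (∑ᵈ E w) ⟩
    n * 36 + (∑ᵈ E w + ∑ᵈ E w) + c * 36
      ≤⟨ +-monoˡ-≤ (c * 36) (+-monoʳ-≤ (n * 36) (≤-trans
           (∑ᵈ-weight α β γ real)
           (≤-reflexive (∑-planarization γ β)))) ⟩
    n * 36 + (#uncrossed * γ + c * 8 * β) + c * 36 ∎)
    where
    open ≤-Reasoning
    open +-*-Solver using (solve; _:+_; _:*_; con; _:=_)
    open Discharging E isFalse false-independent (λ {z} → false-next² E {z})
    w : D×.Dart → ℕ
    w = weight α β
    euler : D×.∣E∣ * 18 + 2 * 18 ≤ (n + c) * 18 + ∑ᵈ E w
    euler = euler-bound E 18 w ¬lonely (quota α β 6≤α 9≤β 18≤α+β)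

-- Bounds for a given drawing

module _ {W : Graph n} (D : OnePlanarDrawing W) where
  open OnePlanarDrawing D renaming (#crossings to c; crossing to X)
  open Graph W using (∣E∣)
  open Crossing
  private
    open +-*-Solver using (solve; _:+_; _:*_; con; _:=_)
    R = #uncrossed W X
    module D× = Graph D×
    open Discharging embedding (isFalse W X) (false-independent W X)
      (λ {z} → false-next² W X embedding {z})

  common-end : ∀ i j {u} → IsEnd (X i) u → IsEnd (X j) u →
    (u ↑ˡ c) ∈ˢ (D×.N (falseVertex i) ∩ D×.N (falseVertex j))
  common-end i j {u} ui uj = x∈p∩q⁺ (Adj⇒∈N D× (end-Adj W X i ui) , Adj⇒∈N D× (end-Adj W X j uj))

  -- The choice 7, 11, 13 leaves 18 - 13 = 5 for `#uncrossed` and 108 - 88 = 20 for `c`, in the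
  -- ratio 1 : 4 of `∣E∣-bound`. The given crossing provides a vertex that is not lonely.
  NIC-bound : (∀ i j → i ≢ j → common i j ≤ 1) → Fin c → ∣E∣ * 5 + 36 ≤ n * 18
  NIC-bound NIC i = *-cancelʳ-≤ _ _ 2 (+-cancelˡ-≤ (R * 13 + c * 88) _ _ (begin
    R * 13 + c * 88 + (∣E∣ * 5 + 36) * 2
      ≡⟨ solve 3 (λ r c e → r :* con 13 :+ c :* con 88 :+ (e :* con 5 :+ con 36) :* con 2 :=
                            r :* con 13 :+ c :* con 88 :+ con 72 :+ (e :+ e) :* con 5) refl R c ∣E∣ ⟩
    R * 13 + c * 88 + 72 + (∣E∣ + ∣E∣) * 5
      ≤⟨ +-monoʳ-≤ (R * 13 + c * 88 + 72) (*-monoˡ-≤ 5 (∣E∣-bound W X)) ⟩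
    R * 13 + c * 88 + 72 + (R + c * 4) * 5
      ≡⟨ solve 2 (λ r c → r :* con 13 :+ c :* con 88 :+ con 72 :+ (r :+ c :* con 4) :* con 5 :=
                          r :* con 18 :+ c :* con 108 :+ con 72) refl R c ⟩
    R * 18 + c * 108 + 72
      ≤⟨ drawing-bound W X embedding (false-not-lonely W X i) 7 11 13
           (m≤m+n 6 1) (m≤m+n 9 2) ≤-refl real ⟩
    n * 36 + (R * 13 + c * 8 * 11)
      ≡⟨ solve 3 (λ n r c → n :* con 36 :+ (r :* con 13 :+ c :* con 8 :* con 11) :=
                            r :* con 13 :+ c :* con 88 :+ n :* con 18 :* con 2) refl n R c ⟩
    R * 13 + c * 88 + n * 18 * 2 ∎))
    where
    open ≤-Reasoning
    few : ∀ {z z′ u v} → T (isFalse W X z) → T (isFalse W X z′) → z ≢ z′ → u ≢ v →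
          D×.Adj z u → D×.Adj z v → D×.Adj z′ u → D×.Adj z′ v → ⊥
    few {z} {z′} Zz Zz′ z≢z′ u≢v zu zv z′u z′v
      with isFalse⇒↑ʳ W X {z} Zz | isFalse⇒↑ʳ W X {z′} Zz′
    ... | i , refl | j , refl = contradiction
      (≤-trans (x,y∈p⇒2≤∣p∣ u≢v
        (x∈p∩q⁺ (Adj⇒∈N D× zu , Adj⇒∈N D× z′u)) (x∈p∩q⁺ (Adj⇒∈N D× zv , Adj⇒∈N D× z′v)))
        (NIC i j (λ i≡j → z≢z′ (cong falseVertex i≡j))))
      λ { (s≤s ()) }
    real : ∀ d → ¬ T (isFalse W X (source D× d)) → ¬ T (isFalse W X (target D× d)) →
           weight 7 11 d + weight 7 11 (reversed D× d) ≤ 13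
    real d ¬Zs ¬Zt with kite? d | kite? (reversed D× d)
    -- Kites on both sides are impossible, so 7 + 6 is the largest total.
    ... | yes k | yes k′ = contradiction k′ (kite-reversed few k)
    ... | yes k | no ¬k′ = ≤-reflexive (cong₂ _+_
      (weight-kite 7 11 d ¬Zs ¬Zt k) (weight-plain 7 11 (reversed D× d) ¬Zt ¬Zs ¬k′))
    ... | no ¬k | yes k′ = ≤-reflexive (cong₂ _+_
      (weight-plain 7 11 d ¬Zs ¬Zt ¬k) (weight-kite 7 11 (reversed D× d) ¬Zt ¬Zs k′))
    ... | no ¬k | no ¬k′ = ≤-trans (≤-reflexive (cong₂ _+_
      (weight-plain 7 11 d ¬Zs ¬Zt ¬k) (weight-plain 7 11 (reversed D× d) ¬Zt ¬Zs ¬k′)))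
      (m≤m+n 12 1)

  -- With α = 6, kites do not count: deleting one edge of each crossing leaves a planar graph.
  planar-bound : ∀ {v} → ¬ Lonely D× v → ∣E∣ + 6 ≤ n * 3 + c
  planar-bound ¬lonely = *-cancelʳ-≤ _ _ 12 (+-cancelˡ-≤ (R * 12 + c * 96) _ _ (begin
    R * 12 + c * 96 + (∣E∣ + 6) * 12
      ≡⟨ solve 3 (λ r c e → r :* con 12 :+ c :* con 96 :+ (e :+ con 6) :* con 12 :=
                            r :* con 12 :+ c :* con 96 :+ con 72 :+ (e :+ e) :* con 6) refl R c ∣E∣ ⟩
    R * 12 + c * 96 + 72 + (∣E∣ + ∣E∣) * 6
      ≤⟨ +-monoʳ-≤ (R * 12 + c * 96 + 72) (*-monoˡ-≤ 6 (∣E∣-bound W X)) ⟩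
    R * 12 + c * 96 + 72 + (R + c * 4) * 6
      ≡⟨ solve 2 (λ r c → r :* con 12 :+ c :* con 96 :+ con 72 :+ (r :+ c :* con 4) :* con 6 :=
                          r :* con 18 :+ c :* con 108 :+ con 72 :+ c :* con 12) refl R c ⟩
    R * 18 + c * 108 + 72 + c * 12
      ≤⟨ +-monoˡ-≤ (c * 12) (drawing-bound W X embedding ¬lonely 6 12 12
           ≤-refl (m≤m+n 9 3) ≤-refl real) ⟩
    n * 36 + (R * 12 + c * 8 * 12) + c * 12
      ≡⟨ solve 3 (λ n r c → n :* con 36 :+ (r :* con 12 :+ c :* con 8 :* con 12) :+ c :* con 12 :=
                            r :* con 12 :+ c :* con 96 :+ (n :* con 3 :+ c) :* con 12) refl n R c ⟩
    R * 12 + c * 96 + (n * 3 + c) * 12 ∎))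
    where
    open ≤-Reasoning
    six : ∀ d → ¬ T (isFalse W X (source D× d)) → ¬ T (isFalse W X (target D× d)) →
          weight 6 12 d ≡ 6
    six d ¬Zs ¬Zt with kite? d
    ... | yes k = weight-kite 6 12 d ¬Zs ¬Zt k
    ... | no ¬k = weight-plain 6 12 d ¬Zs ¬Zt ¬k
    real : ∀ d → ¬ T (isFalse W X (source D× d)) → ¬ T (isFalse W X (target D× d)) →
           weight 6 12 d + weight 6 12 (reversed D× d) ≤ 12
    real d ¬Zs ¬Zt = ≤-reflexive (cong₂ _+_ (six d ¬Zs ¬Zt) (six (reversed D× d) ¬Zt ¬Zs))

  -- No vertex is an end of two crossings, so counting the `c * 4` ends by vertices gives at most
  -- one each.
  IC-#crossings : (∀ i j → i ≢ j → common i j ≡ 0) → c * 4 ≤ n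
  IC-#crossings IC = begin
    c * 4
      ≡⟨ #ends-total W X ⟨
    ∑ (λ i → ∑ λ u → end i u)
      ≡⟨ ∑-comm end ⟩
    ∑ (λ u → ∑ λ i → end i u)
      ≤⟨ ∑-mono once ⟩
    ∑ (λ (u : Fin n) → 1)
      ≡⟨ ∑-const n 1 ⟩
    n * 1
      ≡⟨ *-identityʳ n ⟩
    n ∎
    where
    open ≤-Reasoning
    end : Fin c → Fin n → ℕ
    end i u = ⟦ does (isEnd? (X i) u) ⟧
    same : ∀ {i j u} → IsEnd (X i) u → IsEnd (X j) u → j ≡ i
    same {i} {j} ui uj with j ≟ i
    ... | yes j≡i = j≡i
    ... | no  j≢i with () ← subst (1 ≤_) (IC j i j≢i) (x∈p⇒1≤∣p∣ (common-end j i uj ui))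
    once : ∀ u → ∑ (λ i → end i u) ≤ 1
    once u = by (any? (λ i → isEnd? (X i) u))
      where
      by : Dec (∃ λ i → IsEnd (X i) u) → ∑ (λ i → end i u) ≤ 1
      by (yes (i , ui)) = ≤-trans
        (∑-mono (λ j → ⟦⟧≤ (does (isEnd? (X j) u)) (λ uj → ≤-reflexive (sym (cong ⟦_⟧
          (dec-true (j ≟ i) (same ui (does⇒ (isEnd? (X j) u) uj))))))))
        (≤-reflexive (∑-δ i))
      by (no none) = ≤-trans
        (∑-mono (λ j → ⟦⟧≤ (does (isEnd? (X j) u)) {0}
          (λ uj → contradiction (j , does⇒ (isEnd? (X j) u) uj) none)))
        (≤-trans (≤-reflexive (sum-replicate-zero c)) z≤n)

-- A drawing without crossings would witness class C₀ vacuously, so this one has a crossing, as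
-- `NIC-bound` requires.
Class₁-bound : (W : Graph n) → Class₁ W → Graph.∣E∣ W * 5 + 36 ≤ n * 18
Class₁-bound W (¬class₀ , D , NIC) =
  NIC-bound D NIC (inhabited _ λ none → ¬class₀ (D , λ i → ⊥-elim (none i)))
  where
  inhabited : ∀ c → ¬ ¬ Fin c → Fin c
  inhabited zero    ¬¬i = ⊥-elim (¬¬i λ ())
  inhabited (suc c) ¬¬i = zero

-- The extremal example

iterate : {A : Set} → (A → A) → A → ℕ → A
iterate f x zero    = x
iterate f x (suc k) = f (iterate f x k)

-- Used with `h` forgetting adjacency proofs, so that orbits of darts and neighbours can be checked
-- on bare vertices.
iterate-commute : {A B : Set} {f : A → A} {g : B → B} {x : A} (h : A → B) →
  (∀ a → h (f a) ≡ g (h a)) → ∀ k → h (iterate f x k) ≡ iterate g (h x) k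
iterate-commute         h hf≡gh zero    = refl
iterate-commute {g = g} h hf≡gh (suc k) = trans (hf≡gh _) (cong g (iterate-commute h hf≡gh k))

iterate-orbit : {A : Set} (f : A → A) {x : A} → ∀ k → Setoid._≈_ (orbits f) x (iterate f x k)
iterate-orbit f zero    = ε
iterate-orbit f (suc k) = iterate-orbit f k ◅◅ EqClosure.return refl

module Cuboctahedron where

  open VecMembership (_≟_ {12}) using (_∈?_)

  -- The corners are in cyclic order, so the diagonals join corners 0, 2 and corners 1, 3.
  squares : Vec (Vec (Fin 12) 4) 6
  squares =
    (# 0 ∷ # 1 ∷ # 2 ∷ # 3 ∷ []) ∷
    (# 0 ∷ # 7 ∷ # 8 ∷ # 4 ∷ []) ∷
    (# 1 ∷ # 4 ∷ # 9 ∷ # 5 ∷ []) ∷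
    (# 2 ∷ # 5 ∷ # 10 ∷ # 6 ∷ []) ∷
    (# 3 ∷ # 6 ∷ # 11 ∷ # 7 ∷ []) ∷
    (# 8 ∷ # 11 ∷ # 10 ∷ # 9 ∷ []) ∷
    []

  -- The rotation system of the planarization. Vertices 0 to 11 belong to the cuboctahedron; 12 to
  -- 17 are the centres of the squares, in the order of `squares`.
  around : Vec (List (Fin 18)) 18
  around =
    (# 1 ∷ # 12 ∷ # 3 ∷ # 7 ∷ # 13 ∷ # 4 ∷ []) ∷
    (# 0 ∷ # 4 ∷ # 14 ∷ # 5 ∷ # 2 ∷ # 12 ∷ []) ∷
    (# 1 ∷ # 5 ∷ # 15 ∷ # 6 ∷ # 3 ∷ # 12 ∷ []) ∷
    (# 0 ∷ # 12 ∷ # 2 ∷ # 6 ∷ # 16 ∷ # 7 ∷ []) ∷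
    (# 0 ∷ # 13 ∷ # 8 ∷ # 9 ∷ # 14 ∷ # 1 ∷ []) ∷
    (# 1 ∷ # 14 ∷ # 9 ∷ # 10 ∷ # 15 ∷ # 2 ∷ []) ∷
    (# 3 ∷ # 2 ∷ # 15 ∷ # 10 ∷ # 11 ∷ # 16 ∷ []) ∷
    (# 0 ∷ # 3 ∷ # 16 ∷ # 11 ∷ # 8 ∷ # 13 ∷ []) ∷
    (# 4 ∷ # 13 ∷ # 7 ∷ # 11 ∷ # 17 ∷ # 9 ∷ []) ∷
    (# 4 ∷ # 8 ∷ # 17 ∷ # 10 ∷ # 5 ∷ # 14 ∷ []) ∷
    (# 5 ∷ # 9 ∷ # 17 ∷ # 11 ∷ # 6 ∷ # 15 ∷ []) ∷
    (# 7 ∷ # 16 ∷ # 6 ∷ # 10 ∷ # 17 ∷ # 8 ∷ []) ∷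
    (# 0 ∷ # 1 ∷ # 2 ∷ # 3 ∷ []) ∷
    (# 0 ∷ # 7 ∷ # 8 ∷ # 4 ∷ []) ∷
    (# 1 ∷ # 4 ∷ # 9 ∷ # 5 ∷ []) ∷
    (# 2 ∷ # 5 ∷ # 10 ∷ # 6 ∷ []) ∷
    (# 3 ∷ # 6 ∷ # 11 ∷ # 7 ∷ []) ∷
    (# 8 ∷ # 11 ∷ # 10 ∷ # 9 ∷ []) ∷
    []

  -- All faces of the planarization, as oriented boundary walks: the eight triangles of the
  -- cuboctahedron and four around the centre of each square.
  triangles : Vec (Fin 18 × Fin 18 × Fin 18) 32
  triangles =
    (# 0 , # 1 , # 4) ∷ (# 0 , # 12 , # 1) ∷ (# 0 , # 3 , # 12) ∷ (# 0 , # 7 , # 3) ∷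
    (# 0 , # 13 , # 7) ∷ (# 0 , # 4 , # 13) ∷ (# 1 , # 14 , # 4) ∷ (# 1 , # 5 , # 14) ∷
    (# 1 , # 2 , # 5) ∷ (# 1 , # 12 , # 2) ∷ (# 2 , # 15 , # 5) ∷ (# 2 , # 6 , # 15) ∷
    (# 2 , # 3 , # 6) ∷ (# 2 , # 12 , # 3) ∷ (# 3 , # 16 , # 6) ∷ (# 3 , # 7 , # 16) ∷
    (# 4 , # 8 , # 13) ∷ (# 4 , # 9 , # 8) ∷ (# 4 , # 14 , # 9) ∷ (# 5 , # 9 , # 14) ∷
    (# 5 , # 10 , # 9) ∷ (# 5 , # 15 , # 10) ∷ (# 6 , # 10 , # 15) ∷ (# 6 , # 11 , # 10) ∷
    (# 6 , # 16 , # 11) ∷ (# 7 , # 11 , # 16) ∷ (# 7 , # 8 , # 11) ∷ (# 7 , # 13 , # 8) ∷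
    (# 8 , # 17 , # 11) ∷ (# 8 , # 9 , # 17) ∷ (# 9 , # 10 , # 17) ∷ (# 10 , # 11 , # 17) ∷
    []
  -- The last entry wraps around to `first`; so does any vertex outside the list.
  cycle : ∀ {n} → Fin n → List (Fin n) → Fin n → Fin n
  cycle first []           v = first
  cycle first (x ∷ [])     v = first
  cycle first (x ∷ y ∷ zs) v = if does (x ≟ v) then y else cycle first (y ∷ zs) v

  after : ∀ {n} → List (Fin n) → Fin n → Fin n
  after []       v = v
  after (x ∷ xs) v = cycle x (x ∷ xs) v

  -- Every edge of the cuboctahedron lies on a square, so a common square yields the edges and the
  -- diagonals alike.
  adjW : Fin 12 → Fin 12 → Bool
  adjW u v = not (does (u ≟ v)) ∧
    does (any? λ i → u ∈? lookup squares i ×-dec v ∈? lookup squares i)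

  W : Graph 12
  W = record
    { adj    = adjW
    ; sym    = toWitness {a? = all? λ u → all? λ v → adjW u v Bool.≟ adjW v u} _
    ; irrefl = toWitness {a? = all? λ v → adjW v v Bool.≟ false} _
    }

  corner : Fin 4 → Fin 6 → Fin 12
  corner k i = lookup (lookup squares i) k

  crossing : Fin 6 → Crossing W
  crossing i = record
    { a   = corner (# 0) i
    ; b   = corner (# 2) i
    ; x   = corner (# 1) i
    ; y   = corner (# 3) i
    ; ab  = toWitness {a? = all? λ i → T? (adjW (corner (# 0) i) (corner (# 2) i))} _ i
    ; xy  = toWitness {a? = all? λ i → T? (adjW (corner (# 1) i) (corner (# 3) i))} _ i
    ; a≢x = toWitness {a? = all? λ i → ¬? (corner (# 0) i ≟ corner (# 1) i)} _ i
    ; a≢y = toWitness {a? = all? λ i → ¬? (corner (# 0) i ≟ corner (# 3) i)} _ i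
    ; b≢x = toWitness {a? = all? λ i → ¬? (corner (# 2) i ≟ corner (# 1) i)} _ i
    ; b≢y = toWitness {a? = all? λ i → ¬? (corner (# 2) i ≟ corner (# 3) i)} _ i
    }

  D× : Graph 18
  D× = planarization W crossing

  open Graph D× using (adj; Adj; Adj-sym; Nbr; Dart)

  succ pred : Fin 18 → Fin 18 → Fin 18
  succ u = after (lookup around u)
  pred u = after (reverse (lookup around u))

  face : Fin 18 → Fin 18 → Fin 32
  face u v = find (allFin 32)
    where
    find : List (Fin 32) → Fin 32
    -- A default for pairs that are not darts; every dart lies on one of the triangles.
    find []       = # 0
    find (j ∷ js) = if on (lookup triangles j) then j else find js
      where
      on : Fin 18 × Fin 18 × Fin 18 → Bool
      on (a , b , c) = (is a b ∨ is b c) ∨ is c a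
        where
        is : Fin 18 → Fin 18 → Bool
        is a b = does (u ≟ a) ∧ does (v ≟ b)

  -- The argument u is not among its neighbours, so this is the first of them.
  hub : Fin 18 → Fin 18
  hub u = succ u u

  first : Fin 32 → Fin 18 × Fin 18
  first j = let (a , b , _) = lookup triangles j in a , b

  step : Fin 18 × Fin 18 → Fin 18 × Fin 18
  step (u , v) = v , succ v u

  abstract
    onEdges : {P : Fin 18 → Fin 18 → Set} (P? : ∀ u v → Dec (P u v)) →
      True (all? λ u → all? λ v → T? (adj u v) →-dec P? u v) → ∀ u v → Adj u v → P u v
    onEdges P? = toWitness

    succ-Adj : ∀ u v → Adj u v → Adj u (succ u v)
    succ-Adj = onEdges (λ u v → T? (adj u (succ u v))) _

    pred-Adj : ∀ u v → Adj u v → Adj u (pred u v)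
    pred-Adj = onEdges (λ u v → T? (adj u (pred u v))) _

    pred∘succ : ∀ u v → Adj u v → pred u (succ u v) ≡ v
    pred∘succ = onEdges (λ u v → pred u (succ u v) ≟ v) _

    succ∘pred : ∀ u v → Adj u v → succ u (pred u v) ≡ v
    succ∘pred = onEdges (λ u v → succ u (pred u v) ≟ v) _

    -- Fewer than six steps suffice, since no degree in the planarization exceeds six.
    succ-cyclic : ∀ u v → Adj u v → ∃ λ (k : Fin 6) → iterate (succ u) (hub u) (toℕ k) ≡ v
    succ-cyclic = onEdges (λ u v → any? λ k → iterate (succ u) (hub u) (toℕ k) ≟ v) _

    face-step : ∀ u v → Adj u v → face u v ≡ face v (succ v u)
    face-step = onEdges (λ u v → face u v ≟ face v (succ v u)) _

    -- Fewer than three steps suffice, since every face is a triangle.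
    step-cyclic : ∀ u v → Adj u v →
      ∃ λ (k : Fin 3) → iterate step (first (face u v)) (toℕ k) ≡ (u , v)
    step-cyclic = onEdges (λ u v → any? λ k →
      Product.≡-dec _≟_ _≟_ (iterate step (first (face u v)) (toℕ k)) (u , v)) _

    first-Adj : ∀ j → Adj (proj₁ (first j)) (proj₂ (first j))
    first-Adj = toWitness {a? = all? λ j → T? (adj (proj₁ (first j)) (proj₂ (first j)))} _

    face-first : ∀ j → face (proj₁ (first j)) (proj₂ (first j)) ≡ j
    face-first = toWitness {a? = all? λ j → face (proj₁ (first j)) (proj₂ (first j)) ≟ j} _

    hub-Adj : ∀ u → Adj u (hub u)
    hub-Adj = toWitness {a? = all? λ u → T? (adj u (hub u))} _

    -- Connectivity: following first neighbours leads to vertex 0 in at most three steps.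
    hub-root : ∀ u → ∃ λ (k : Fin 4) → iterate hub u (toℕ k) ≡ # 0
    hub-root = toWitness {a? = all? λ u → any? λ k → iterate hub u (toℕ k) ≟ # 0} _

    -- There are 48 edges: the 24 of the cuboctahedron, which stay uncrossed, and four half-edges in
    -- each square.
    euler : 18 + (32 + length (Graph.isolated D×)) ≡ Graph.∣E∣ D× + 2 * 1
    euler = refl

    once : ∀ i j u v →
      Crossing.Involves (crossing i) u v → Crossing.Involves (crossing j) u v → i ≡ j
    once = toWitness {a? = all? λ i → all? λ j → all? λ u → all? λ v →
      Crossing.involves? (crossing i) u v →-dec Crossing.involves? (crossing j) u v →-dec i ≟ j} _

    opposite : ∀ i u v → Crossing.Involves (crossing i) u v →
      succ (12 ↑ʳ i) (succ (12 ↑ʳ i) (u ↑ˡ 6)) ≡ v ↑ˡ 6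
    opposite = toWitness {a? = all? λ i → all? λ u → all? λ v →
      Crossing.involves? (crossing i) u v →-dec succ (12 ↑ʳ i) (succ (12 ↑ʳ i) (u ↑ˡ 6)) ≟ v ↑ˡ 6} _

    -- The neighbours of a false vertex are the corners of its square, and squares of the
    -- cuboctahedron have no edge in common.
    sharing : ∀ i j → i ≢ j → ∣ Graph.N D× (12 ↑ʳ i) ∩ Graph.N D× (12 ↑ʳ j) ∣ ≤ 1
    sharing = toWitness {a? = all? λ i → all? λ j →
      ¬? (i ≟ j) →-dec ∣ Graph.N D× (12 ↑ʳ i) ∩ Graph.N D× (12 ↑ʳ j) ∣ ℕ.≤? 1} _

  rotation : ∀ u → Nbr u ↔ Nbr u
  rotation u = mk↔ₛ′
    (λ (v , uv) → succ u v , succ-Adj u v uv)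
    (λ (v , uv) → pred u v , pred-Adj u v uv)
    (λ (v , uv) → Nbr-≡ D× {u} (succ∘pred u v uv))
    (λ (v , uv) → Nbr-≡ D× {u} (pred∘succ u v uv))

  next : ∀ {u} → Nbr u → Nbr u
  next {u} = Inverse.to (rotation u)

  next-cyclic : ∀ {u} (p : Nbr u) → Setoid._≈_ (orbits (next {u})) (hub u , hub-Adj u) p
  next-cyclic {u} (v , uv) with succ-cyclic u v uv
  ... | k , eq = subst (Setoid._≈_ (orbits (next {u})) _)
    (Nbr-≡ D× {u} (trans (iterate-commute proj₁ (λ _ → refl) (toℕ k)) eq))
    (iterate-orbit (next {u}) (toℕ k))

  faceStep : Dart → Dart
  faceStep (u , v , uv) = v , next {v} (u , Adj-sym {u} {v} uv)

  rep : Fin 32 → Dart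
  rep j = proj₁ (first j) , proj₂ (first j) , first-Adj j

  faceOf : Dart → Fin 32
  faceOf (u , v , _) = face u v

  rep-face : ∀ d → Setoid._≈_ (orbits faceStep) (rep (faceOf d)) d
  rep-face (u , v , uv) with step-cyclic u v uv
  ... | k , eq = subst (Setoid._≈_ (orbits faceStep) _)
    (ends-injective D× (trans (iterate-commute (ends D×) (λ _ → refl) (toℕ k)) eq))
    (iterate-orbit faceStep (toℕ k))

  faces : HasClasses (orbits faceStep) 32
  faces = record
    { to        = faceOf
    ; cong      = faceOf-cong
    ; bijective =
        (λ {d} {e} eq → sym≈ (rep-face d) ◅◅
          subst (λ j → Setoid._≈_ (orbits faceStep) (rep j) e) (sym eq) (rep-face e)) ,
        (λ j → rep j , λ d≈ → trans (faceOf-cong d≈) (face-first j))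
    }
    where
    sym≈ = Setoid.sym (orbits faceStep)
    faceOf-cong : ∀ {d e} → Setoid._≈_ (orbits faceStep) d e → faceOf d ≡ faceOf e
    faceOf-cong = EqClosure.gfold isEquivalence faceOf λ { {u , v , uv} refl → face-step u v uv }

  comps : HasClasses (Graph.components D×) 1
  comps = record
    { to        = λ _ → zero
    ; cong      = λ _ → refl
    ; bijective =
        (λ {u} {v} _ → root u ◅◅ EqClosure.symmetric Adj (root v)) , λ { zero → zero , λ _ → refl }
    }
    where
    path : ∀ u k → EqClosure Adj u (iterate hub u k)
    path u zero    = ε
    path u (suc k) = path u k ◅◅ EqClosure.return (hub-Adj (iterate hub u k))
    root : ∀ u → EqClosure Adj u (# 0)
    root u with hub-root u
    ... | k , eq = subst (EqClosure Adj u) eq (path u (toℕ k))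

  drawing : OnePlanarDrawing W
  drawing = record
    { #crossings   = 6
    ; crossing     = crossing
    ; crossed-once = λ i j → once i j _ _
    ; embedding    = record
      { rotation = rotation
      ; cyclic   = λ u p q → Setoid.sym (orbits (next {u})) (next-cyclic p) ◅◅ next-cyclic q
      ; #faces   = 32
      ; faces    = faces
      ; #comps   = 1
      ; comps    = comps
      ; genus-0  = euler
      }
    ; transversal  = λ { i {u} {v} inv (_ , _) refl → opposite i u v inv }
    }

  -- By `planar-bound`, 36 edges on 12 vertices force at least six crossings. In a drawing for class
  -- C₀ these would have 24 distinct ends.
  not-Class₀ : ¬ Class₀ W
  not-Class₀ (D , IC) = toWitnessFalse {a? = 24 ℕ.≤? 12} _
    (≤-trans (*-monoˡ-≤ 4 six) (IC-#crossings D IC))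
    where
    open OnePlanarDrawing D using (#crossings) renaming (crossing to X)
    -- Without crossings vertex 0 keeps the neighbours 1 and 2; otherwise a false vertex serves.
    not-lonely : ∀ c (X : Fin c → Crossing W) → ∃ λ p → ¬ Lonely (planarization W X) p
    not-lonely zero    X = # 0 , λ (w , only) → contradiction
      (trans (proj₁ (only (# 1)) _) (sym (proj₁ (only (# 2)) _))) λ ()
    not-lonely (suc c) X = 12 ↑ʳ zero , false-not-lonely W X zero
    six : 6 ≤ #crossings
    six = +-cancelˡ-≤ 36 6 _ (planar-bound D (proj₂ (not-lonely #crossings X)))

-- The bound over the rationals, and the theorem

open import Data.Integer using (+_)

-- The inequality is first shown with 7.2 moved to the left, by cross-multiplication of unnormalised
-- fractions; then 7.2 is subtracted.
scaled-≤ : ∀ m n → m * 5 + 36 ≤ n * 18 →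
  toℚ m ℚ.≤ (+ 36 ℚ./ 10) ℚ.* toℚ n ℚ.- (+ 72 ℚ./ 10)
scaled-≤ m n le = subst (ℚ._≤ bound) (cancel (toℚ m)) (ℚ.+-monoˡ-≤ (ℚ.- c) lifted)
  where
  c = + 72 ℚ./ 10
  bound = (+ 36 ℚ./ 10) ℚ.* toℚ n ℚ.- c
  cancel : ∀ p → p ℚ.+ c ℚ.- c ≡ p
  cancel p = trans (ℚ.+-assoc p c (ℚ.- c)) (trans (cong (p ℚ.+_) (ℚ.+-inverseʳ c)) (ℚ.+-identityʳ p))
  toℚᵘ-toℚ : ∀ k → ℚ.toℚᵘ (toℚ k) ℚᵘ.≃ mkℚᵘ (+ k) 0
  toℚᵘ-toℚ k = ℚ.toℚᵘ-fromℚᵘ (mkℚᵘ (+ k) 0)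
  -- The fractions 72/10 and 36/10 reduce to 36/5 and 18/5; `mkℚᵘ` takes the denominator minus one.
  lhs = mkℚᵘ (+ m) 0 ℚᵘ.+ mkℚᵘ (+ 36) 4
  rhs = mkℚᵘ (+ 18) 4 ℚᵘ.* mkℚᵘ (+ n) 0
  crossed : (+ m ℤ.* + 5 ℤ.+ + 36 ℤ.* + 1) ℤ.* + 5 ℤ.≤ (+ 18 ℤ.* + n) ℤ.* + 5
  crossed = ℤ.*-monoʳ-≤-nonNeg (+ 5) (subst₂ ℤ._≤_
    (cong (ℤ._+ + 36) (ℤ.pos-* m 5))
    (trans (cong +_ (*-comm n 18)) (ℤ.pos-* 18 n)) (ℤ.+≤+ le))
  lifted : toℚ m ℚ.+ c ℚ.≤ (+ 36 ℚ./ 10) ℚ.* toℚ n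
  lifted = ℚ.toℚᵘ-cancel-≤ (begin
    ℚ.toℚᵘ (toℚ m ℚ.+ c)             ≃⟨ ℚ.toℚᵘ-homo-+ (toℚ m) c ⟩
    ℚ.toℚᵘ (toℚ m) ℚᵘ.+ ℚ.toℚᵘ c     ≃⟨ ℚᵘ.+-congˡ (ℚ.toℚᵘ c) (toℚᵘ-toℚ m) ⟩
    lhs                              ≤⟨ *≤* (crossed) ⟩
    rhs                              ≃⟨ ℚᵘ.*-congˡ {ℚ.toℚᵘ (+ 36 ℚ./ 10)} (toℚᵘ-toℚ n) ⟨
    ℚ.toℚᵘ (+ 36 ℚ./ 10) ℚᵘ.* ℚ.toℚᵘ (toℚ n)  ≃⟨ ℚ.toℚᵘ-homo-* (+ 36 ℚ./ 10) (toℚ n) ⟨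
    ℚ.toℚᵘ ((+ 36 ℚ./ 10) ℚ.* toℚ n) ∎)
    where open ℚᵘ.≤-Reasoning

theorem20 : ((n : ℕ) (W : Graph n) → Class₁ W →
    toℚ (Graph.∣E∣ W) ℚ.≤ (+ 36 ℚ./ 10) ℚ.* toℚ n ℚ.- (+ 72 ℚ./ 10))
    × (Σ ℕ λ n → Σ (Graph n) λ W → Class₁ W ×
    toℚ (Graph.∣E∣ W) ≡ (+ 36 ℚ./ 10) ℚ.* toℚ n ℚ.- (+ 72 ℚ./ 10))
theorem20 =
  (λ n W class₁ → scaled-≤ (Graph.∣E∣ W) n (Class₁-bound W class₁)) ,
  -- Both sides of the final equation evaluate to 36.
  12 , W , (not-Class₀ , drawing , sharing) , refl
  where open Cuboctahedron
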